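{- For every constant $c_0>0$ there is a constant $C>0$ such that the following holds. Let $n\ge 1$, let $\varepsilon\in(0,1)$ satisfy $\varepsilon\ge c_0/\sqrt{n}$, and let $U$ be a finite universe. There is a randomized one-pass streaming algorithm (with access to public randomness) that uses at most $C\cdot \log(2+\varepsilon^2 n)/\varepsilon^2$ bits of space and such that, for every stream of length $n$ over $U$, it outputs with probability greater than $2/3$ a $(1\pm\varepsilon)$-approximation of the second frequency moment $F_2$ of the stream. (That is, for $\varepsilon=\Omega(1/\sqrt n)$, space $O(\log(\varepsilon^2 n)/\varepsilon^2)$ suffices.)
   Context: A stream of length $n$ over a finite universe $U$ is a sequence $(x_1,\dots,x_n)\in U^n$. For $x\in U$ its frequency is $f_x=|\{i: x_i=x\}|$, and $F_2=\sum_{x\in U} f_x^2$. A value $A$ is a $(1\pm\varepsilon)$-approximation of $F_2$ if $(1-\varepsilon)F_2\le A\le(1+\varepsilon)F_2$. A one-pass streaming algorithm reads the stream elements one by one, updating a memory state after each element, and computes its output from the final memory state. Access to public randomness means that the algorithm may, at every step, consult a random string (for instance, random hash functions on $U$) drawn before, and independently of, the stream; this string is not counted in the space. The space is the number of bits needed to store the memory state. The probability is over the random string. -}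

module Defs where

import Algebra.Definitions.RawSemiring as Power
open import Data.Bool.Base using (Bool; true; false; if_then_else_; T)
open import Data.Fin.Base using (Fin)
import Data.Fin.Properties as Fin
open import Data.Integer.Base using (ℤ; +_; -[1+_])
open import Data.Nat.Base as ℕ using (ℕ; zero; suc)
open import Data.Nat.Properties using (m^n≢0)
open import Data.Product using (_×_; ∃; ∃-syntax)
open import Data.Rational.Base as ℚ using (ℚ; ↥_; ↧ₙ_; 0ℚ; 1ℚ; ½; +-*-rawSemiring)
open import Data.Sum using (_⊎_)
open import Data.Vec.Base using (Vec; []; _∷_; foldl; count; sum; tabulate)
open import Relation.Nullary using (¬_)

-- Real numbers as two-sided Dedekind cuts in ℚ: `below x q` reads q < x, and `above x q` reads x < q.
-- The operations are defined on raw cuts; a real number is a raw cut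
-- satisfying IsReal.
record Cut : Set₁ where
  field
    below above : ℚ → Set

open Cut public

record IsReal (x : Cut) : Set where
  field
    below-inhabited : ∃[ q ] below x q
    above-inhabited : ∃[ q ] above x q
    below-down      : ∀ {q r} → q ℚ.< r → below x r → below x q
    above-up        : ∀ {q r} → q ℚ.< r → above x q → above x r
    below-open      : ∀ {q} → below x q → ∃[ r ] q ℚ.< r × below x r
    above-open      : ∀ {r} → above x r → ∃[ q ] q ℚ.< r × above x q
    disjoint        : ∀ {q} → ¬ (below x q × above x q)
    located         : ∀ {q r} → q ℚ.< r → below x q ⊎ above x r

infix  4 _≤_ _<_
infixl 6 _+_ _-_
infixl 7 _*_ _/_

_≤_ : Cut → Cut → Set
x ≤ y = ∀ q → below x q → below y q

_<_ : Cut → Cut → Set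
x < y = ∃[ q ] above x q × below y q

fromℚ : ℚ → Cut
fromℚ q = record { below = ℚ._< q ; above = q ℚ.<_ }

fromℕ : ℕ → Cut
fromℕ n = fromℚ (+ n ℚ./ 1)

_+_ : Cut → Cut → Cut
x + y = record
  { below = λ q → ∃[ a ] ∃[ b ] below x a × below y b × q ℚ.< a ℚ.+ b
  ; above = λ q → ∃[ a ] ∃[ b ] above x a × above y b × a ℚ.+ b ℚ.< q
  }

_-_ : Cut → Cut → Cut
x - y = record
  { below = λ q → ∃[ a ] ∃[ b ] below x a × above y b × q ℚ.< a ℚ.- b
  ; above = λ q → ∃[ a ] ∃[ b ] above x a × below y b × a ℚ.- b ℚ.< q
  }

Between : Cut → ℚ → ℚ → Set
Between x a b = below x a × above x b

-- Interval multiplication: if a < x < b and c < y < d, then x * y lies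
-- strictly between the least and the greatest of ac, ad, bc, bd.
_*_ : Cut → Cut → Cut
x * y = record
  { below = λ q → ∃[ a ] ∃[ b ] ∃[ c ] ∃[ d ] Between x a b × Between y c d ×
      q ℚ.< a ℚ.* c × q ℚ.< a ℚ.* d × q ℚ.< b ℚ.* c × q ℚ.< b ℚ.* d
  ; above = λ q → ∃[ a ] ∃[ b ] ∃[ c ] ∃[ d ] Between x a b × Between y c d ×
      a ℚ.* c ℚ.< q × a ℚ.* d ℚ.< q × b ℚ.* c ℚ.< q × b ℚ.* d ℚ.< q
  }

-- Meaningful for 0 < y only: q < x / y iff q * y < x, where q * y lies
-- between q * c and q * d whenever 0 < c < y < d.
_/_ : Cut → Cut → Cut
x / y = record
  { below = λ q → ∃[ a ] ∃[ c ] ∃[ d ] below x a × Between y c d ×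
      0ℚ ℚ.< c × q ℚ.* c ℚ.< a × q ℚ.* d ℚ.< a
  ; above = λ q → ∃[ b ] ∃[ c ] ∃[ d ] above x b × Between y c d ×
      0ℚ ℚ.< c × b ℚ.< q ℚ.* c × b ℚ.< q ℚ.* d
  }

-- Meaningful for 0 ≤ x only.
√_ : Cut → Cut
√ x = record
  { below = λ q → q ℚ.< 0ℚ ⊎ below x (q ℚ.* q)
  ; above = λ q → 0ℚ ℚ.< q × above x (q ℚ.* q)
  }

infix 8 √_

open Power +-*-rawSemiring using (_^_)

pow2 : ℤ → ℚ
pow2 (+ k)    = (1ℚ ℚ.+ 1ℚ) ^ k
pow2 -[1+ k ] = ½ ^ suc k

-- Meaningful for 0 < x only.  For q = p / m with m > 0 and for a > 0,
-- q < log₂ a iff 2 ^ p < a ^ m.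
log₂ : Cut → Cut
log₂ x = record
  { below = λ q → ∃[ a ] 0ℚ ℚ.< a × below x a × pow2 (↥ q) ℚ.< a ^ ↧ₙ q
  ; above = λ q → ∃[ a ] 0ℚ ℚ.< a × above x a × a ^ ↧ₙ q ℚ.< pow2 (↥ q)
  }

#_ : ∀ {ℓ} → (Vec Bool ℓ → Bool) → ℕ
#_ {zero}  E = if E [] then 1 else 0
#_ {suc ℓ} E = (# λ r → E (false ∷ r)) ℕ.+ (# λ r → E (true ∷ r))

-- Probability under the uniform distribution on bit strings of length ℓ.
Pr : ∀ {ℓ} → (Vec Bool ℓ → Bool) → ℚ
Pr {ℓ} E = (+ (# E)) ℚ./ (2 ℕ.^ ℓ)
  where instance _ = m^n≢0 2 ℓ

-- An event about real numbers need not be decidable, so "P has probability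
-- greater than p" is witnessed by a decidable event contained in P.
-- Classically one may take that event to be P itself.
ProbabilityExceeds : ∀ {ℓ} → ℚ → (Vec Bool ℓ → Set) → Set
ProbabilityExceeds {ℓ} p P =
  ∃[ E ] (∀ (r : Vec Bool ℓ) → T (E r) → P r) × p ℚ.< Pr E

Stream : ℕ → ℕ → Set
Stream u n = Vec (Fin u) n

frequency : ∀ {u n} → Stream u n → Fin u → ℕ
frequency xs x = count (x Fin.≟_) xs

F₂ : ∀ {u n} → Stream u n → ℕ
F₂ xs = sum (tabulate λ x → frequency xs x ℕ.^ 2)

-- The memory holds s bits.  The public random string of ℓ bits can be read
-- at every step and is not part of the memory.
record StreamingAlgorithm (u s ℓ : ℕ) : Set where
  field
    initial : Vec Bool s
    update  : Vec Bool ℓ → Vec Bool s → Fin u → Vec Bool s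
    output  : Vec Bool ℓ → Vec Bool s → ℚ

  run : ∀ {n} → Vec Bool ℓ → Stream u n → ℚ
  run r xs = output r (foldl (λ _ → Vec Bool s) (update r) initial xs)

open StreamingAlgorithm public using (run)

IsApproximation : Cut → ℕ → ℚ → Set
IsApproximation ε F A =
  ((fromℕ 1 - ε) * fromℕ F ≤ fromℚ A) × (fromℚ A ≤ (fromℕ 1 + ε) * fromℕ F)

{-# OPTIONS --safe #-}

-- Hash every universe element to one of k = O(1/ε²) buckets with a random sign,
-- and estimate F₂ by the sum of the squared signed bucket counts.  Adding one
-- element of frequency a to a sketch whose bucket holds d changes the estimate by
-- a² ± 2ad, so the error is a martingale with independent signs, and its second
-- moment is at most 2 F₂² / k: Chebyshev's inequality applies.
--
-- The counts of the 2k (sign, bucket) pairs are natural numbers with sum at most n.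
-- Splitting each into b ≈ log₂ (n / k) low-order bits and a unary quotient
-- (Golomb–Rice coding) stores all of them in O(k (b + 1)) bits, which is
-- O(log (2 + ε² n) / ε²).
module Submission where

open import Defs as ℝ using (Cut; IsReal; below; above; Between; fromℚ; fromℕ; log₂; pow2; #_; Pr; ProbabilityExceeds; Stream; frequency; F₂; StreamingAlgorithm; run; IsApproximation)
import Algebra.Definitions.RawSemiring as Power
open import Data.Bool.Base using (Bool; true; false; if_then_else_; T)
import Data.Bool.Properties as Bool
open import Data.Fin.Base as Fin using (Fin)
import Data.Fin.Properties as Fin
open import Data.Integer.Base as ℤ using (ℤ; +_)
import Data.Integer.Properties as ℤ
import Data.Integer.Tactic.RingSolver as ℤ
open import Data.List.Base as List using (List; []; _∷_; _++_; length)
import Data.List.Properties as List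
open import Data.Nat.Base as ℕ using (ℕ; zero; suc; z≤n; s≤s)
import Data.Nat.Coprimality as ℕ
import Data.Nat.DivMod as ℕ
import Data.Nat.Properties as ℕ
import Data.Nat.Tactic.RingSolver as ℕ
open import Data.Product as Product using (_×_; _,_; ∃-syntax; proj₁; proj₂)
open import Data.Rational.Base as ℚ using (ℚ; mkℚ; ↥_; ↧ₙ_)
import Data.Rational.Properties as ℚ
import Data.Rational.Unnormalised.Base as ℚᵘ
import Data.Rational.Unnormalised.Properties as ℚᵘ
open import Data.Sum.Base using (_⊎_; inj₁; inj₂; [_,_]′)
open import Data.Vec.Base as Vec using (Vec; []; _∷_; take; drop; sum; tabulate; toList; foldl)
import Data.Vec.Properties as Vec
open import Function.Base using (_∘_; const)
open import Level using (0ℓ)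
open import Relation.Binary.PropositionalEquality
open import Relation.Nullary.Decidable using (Dec; does; yes; no; dec⇒maybe)
open import Relation.Nullary.Negation using (contradiction)
open import Tactic.RingSolver using (solve-∀)
open import Tactic.RingSolver.Core.AlmostCommutativeRing using (AlmostCommutativeRing; fromCommutativeRing)

-- Golomb–Rice coding of histograms

-- Counters of fixed width would cost `log n` bits each. Natural counts instead of signed ones are
-- what makes the shorter code work: whatever the hash values, the counts sum to the number of
-- elements read, so the unary quotients have bounded total length and the space bound holds for
-- every random string, not only with high probability.
--
-- Hash values are uniform bit strings, a fresh block for each universe element, so the number of
-- buckets is a power of two and independence is a splitting of the random string. Expectations
-- appear as integer sums over all random strings, with the number of strings kept as a factor.
--
-- A real `ε` cannot be compared exactly with a rational, so all parameters derive from a dyadic `z`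
-- with `z < ε < 4 z`. The factor 4 is the price of locating a cut; its square, together with the
-- slack that open intervals require, accounts for the size of the final constant.

bit : Bool → ℕ
bit b = if b then 1 else 0

bit-≡ᵇ1 : ∀ {r} → r ℕ.< 2 → bit (r ℕ.≡ᵇ 1) ≡ r
bit-≡ᵇ1 {0} _ = refl
bit-≡ᵇ1 {1} _ = refl
bit-≡ᵇ1 {suc (suc _)} (s≤s (s≤s ()))

code : ℕ → ℕ → List Bool
code zero    zero    = false ∷ []
code zero    (suc v) = true ∷ code zero v
code (suc b) v       = (v ℕ.% 2 ℕ.≡ᵇ 1) ∷ code b (v ℕ./ 2)

decode : ℕ → List Bool → ℕ × List Bool
-- A default: every codeword ends in `false`, so decoding one never exhausts the input here.
decode zero    []          = 0 , []
decode zero    (false ∷ l) = 0 , l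
decode zero    (true ∷ l)  = Product.map₁ suc (decode zero l)
decode (suc b) []          = 0 , []
decode (suc b) (x ∷ l)     = Product.map₁ (λ v → bit x ℕ.+ v ℕ.* 2) (decode b l)

-- The arbitrary tail `l` expresses that the code is self-delimiting: codewords are concatenated
-- without separators, and padding is just another tail.
decode-code : ∀ b v l → decode b (code b v ++ l) ≡ (v , l)
decode-code zero    zero    l = refl
decode-code zero    (suc v) l = cong (Product.map₁ suc) (decode-code zero v l)
decode-code (suc b) v       l
  rewrite decode-code b (v ℕ./ 2) l | bit-≡ᵇ1 (ℕ.m%n<n v 2) =
  cong (_, l) (sym (ℕ.m≡m%n+[m/n]*n v 2))

-- A codeword has `b + 1` bits plus the quotient of `v` by `2 ^ b`. Multiplying through by `2 ^ b`
-- avoids floors and makes the bound additive, so that over a histogram only the total of the counts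
-- enters.
length-code : ∀ b v → 2 ℕ.^ b ℕ.* length (code b v) ℕ.≤ 2 ℕ.^ b ℕ.* suc b ℕ.+ v
length-code zero zero    = ℕ.≤-refl
length-code zero (suc v) = s≤s (length-code zero v)
length-code (suc b) v = begin
  2 ℕ.* B ℕ.* suc L                       ≡⟨ split B L ⟩
  2 ℕ.* B ℕ.+ 2 ℕ.* (B ℕ.* L)             ≤⟨ ℕ.+-monoʳ-≤ (2 ℕ.* B) (ℕ.*-monoʳ-≤ 2 (length-code b h)) ⟩
  2 ℕ.* B ℕ.+ 2 ℕ.* (B ℕ.* suc b ℕ.+ h)   ≡⟨ merge B b h ⟩
  2 ℕ.* B ℕ.* suc (suc b) ℕ.+ h ℕ.* 2     ≤⟨ ℕ.+-monoʳ-≤ (2 ℕ.* B ℕ.* suc (suc b)) (ℕ.m/n*n≤m v 2) ⟩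
  2 ℕ.* B ℕ.* suc (suc b) ℕ.+ v           ∎
  where
  open ℕ.≤-Reasoning
  B = 2 ℕ.^ b
  h = v ℕ./ 2
  L = length (code b h)
  split : ∀ B L → 2 ℕ.* B ℕ.* suc L ≡ 2 ℕ.* B ℕ.+ 2 ℕ.* (B ℕ.* L)
  split = solve-∀ ℕ.ring
  merge : ∀ B b h → 2 ℕ.* B ℕ.+ 2 ℕ.* (B ℕ.* suc b ℕ.+ h) ≡ 2 ℕ.* B ℕ.* suc (suc b) ℕ.+ h ℕ.* 2
  merge = solve-∀ ℕ.ring

Histogram : ℕ → Set
Histogram w = Vec Bool w → ℕ

total : ∀ {w} → Histogram w → ℕ
total {zero}  p = p []
total {suc w} p = total (p ∘ (false ∷_)) ℕ.+ total (p ∘ (true ∷_))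

total-cong : ∀ {w} {p q : Histogram w} → p ≗ q → total p ≡ total q
total-cong {zero}  p≗q = p≗q []
total-cong {suc w} p≗q = cong₂ ℕ._+_ (total-cong (p≗q ∘ (false ∷_))) (total-cong (p≗q ∘ (true ∷_)))

total-0 : ∀ w → total {w} (const 0) ≡ 0
total-0 zero    = refl
total-0 (suc w) = cong₂ ℕ._+_ (total-0 w) (total-0 w)

codeAll : ∀ b {w} → Histogram w → List Bool
codeAll b {zero}  p = code b (p [])
codeAll b {suc w} p = codeAll b (p ∘ (false ∷_)) ++ codeAll b (p ∘ (true ∷_))

branch : ∀ {w} → Histogram w → Histogram w → Histogram (suc w)
branch p q (false ∷ v) = p v
branch p q (true ∷ v)  = q v

decodeAll : ∀ b w → List Bool → Histogram w × List Bool
decodeAll b zero    l = Product.map₁ const (decode b l)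
decodeAll b (suc w) l =
  let p , l′ = decodeAll b w l
      q , l″ = decodeAll b w l′
  in branch p q , l″

decodeAll-codeAll : ∀ b {w} (p : Histogram w) l →
  proj₁ (decodeAll b w (codeAll b p ++ l)) ≗ p × proj₂ (decodeAll b w (codeAll b p ++ l)) ≡ l
decodeAll-codeAll b {zero} p l rewrite decode-code b (p []) l = (λ { [] → refl }) , refl
decodeAll-codeAll b {suc w} p l
  rewrite List.++-assoc (codeAll b (p ∘ (false ∷_))) (codeAll b (p ∘ (true ∷_))) l
        | proj₂ (decodeAll-codeAll b (p ∘ (false ∷_)) (codeAll b (p ∘ (true ∷_)) ++ l)) =
  (λ { (false ∷ v) → proj₁ (decodeAll-codeAll b (p ∘ (false ∷_)) _) v
     ; (true ∷ v)  → proj₁ (decodeAll-codeAll b (p ∘ (true ∷_)) l) v })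
  , proj₂ (decodeAll-codeAll b (p ∘ (true ∷_)) l)

length-codeAll : ∀ b {w} (p : Histogram w) →
  2 ℕ.^ b ℕ.* length (codeAll b p) ℕ.≤ 2 ℕ.^ b ℕ.* (2 ℕ.^ w ℕ.* suc b) ℕ.+ total p
length-codeAll b {zero} p rewrite ℕ.*-identityˡ (suc b) = length-code b (p [])
length-codeAll b {suc w} p = begin
  B ℕ.* length (l₀ ++ l₁)                          ≡⟨ cong (B ℕ.*_) (List.length-++ l₀) ⟩
  B ℕ.* (length l₀ ℕ.+ length l₁)                  ≡⟨ ℕ.*-distribˡ-+ B (length l₀) (length l₁) ⟩
  B ℕ.* length l₀ ℕ.+ B ℕ.* length l₁              ≤⟨ ℕ.+-mono-≤ (length-codeAll b p₀) (length-codeAll b p₁) ⟩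
  (B ℕ.* (W ℕ.* suc b) ℕ.+ total p₀) ℕ.+ (B ℕ.* (W ℕ.* suc b) ℕ.+ total p₁)
                                                   ≡⟨ merge B W b (total p₀) (total p₁) ⟩
  B ℕ.* (2 ℕ.* W ℕ.* suc b) ℕ.+ (total p₀ ℕ.+ total p₁) ∎
  where
  open ℕ.≤-Reasoning
  B = 2 ℕ.^ b
  W = 2 ℕ.^ w
  p₀ = p ∘ (false ∷_)
  p₁ = p ∘ (true ∷_)
  l₀ = codeAll b p₀
  l₁ = codeAll b p₁
  merge : ∀ B W b x y → (B ℕ.* (W ℕ.* suc b) ℕ.+ x) ℕ.+ (B ℕ.* (W ℕ.* suc b) ℕ.+ y)
          ≡ B ℕ.* (2 ℕ.* W ℕ.* suc b) ℕ.+ (x ℕ.+ y)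
  merge = solve-∀ ℕ.ring

-- An encoding that is too long is cut off; the size hypothesis of `load-store` excludes that case.
pad : ∀ s → List Bool → Vec Bool s
pad zero    _       = []
pad (suc s) []      = false ∷ pad s []
pad (suc s) (x ∷ l) = x ∷ pad s l

toList-pad : ∀ s l → length l ℕ.≤ s → ∃[ l′ ] toList (pad s l) ≡ l ++ l′
toList-pad s       []      _         = toList (pad s []) , refl
toList-pad (suc s) (x ∷ l) (s≤s len) = Product.map₂ (cong (x ∷_)) (toList-pad s l len)

store : ∀ b s {w} → Histogram w → Vec Bool s
store b s p = pad s (codeAll b p)

load : ∀ b {s} w → Vec Bool s → Histogram w
load b w m = proj₁ (decodeAll b w (toList m))

load-store : ∀ b s {w} (p : Histogram w) →
  2 ℕ.^ b ℕ.* (2 ℕ.^ w ℕ.* suc b) ℕ.+ total p ℕ.≤ 2 ℕ.^ b ℕ.* s →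
  load b w (store b s p) ≗ p
load-store b s {w} p fits v =
  let instance _ = ℕ.m^n≢0 2 b
      l′ , eq = toList-pad s (codeAll b p)
        (ℕ.*-cancelˡ-≤ (2 ℕ.^ b) (ℕ.≤-trans (length-codeAll b p) fits))
  in trans (cong (λ l → proj₁ (decodeAll b w l) v) eq) (proj₁ (decodeAll-codeAll b p l′) v)

-- Hashing a stream into a histogram

point : ∀ {w} → ℕ → Vec Bool w → Histogram w
point a h v = if does (Vec.≡-dec Bool._≟_ h v) then a else 0

point-+ : ∀ {w} a b (h v : Vec Bool w) → point (a ℕ.+ b) h v ≡ point a h v ℕ.+ point b h v
point-+ a b h v with does (Vec.≡-dec Bool._≟_ h v)
... | true  = refl
... | false = refl

point-0 : ∀ {w} (h v : Vec Bool w) → point 0 h v ≡ 0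
point-0 h v with does (Vec.≡-dec Bool._≟_ h v)
... | true  = refl
... | false = refl

bump : ∀ {w} → Vec Bool w → Histogram w → Histogram w
bump h p v = point 1 h v ℕ.+ p v

total-bump : ∀ {w} (h : Vec Bool w) p → total (bump h p) ≡ suc (total p)
total-bump [] p = refl
total-bump (false ∷ h) p = cong (ℕ._+ total (p ∘ (true ∷_))) (total-bump h (p ∘ (false ∷_)))
total-bump (true ∷ h)  p =
  trans (cong (total (p ∘ (false ∷_)) ℕ.+_) (total-bump h (p ∘ (true ∷_)))) (ℕ.+-suc _ _)

hash : ∀ w {u} → Vec Bool (u ℕ.* w) → Fin u → Vec Bool w
hash w r Fin.zero    = take w r
hash w r (Fin.suc x) = hash w (drop w r) x

-- The sketch described offline, by recursion on the universe instead of the stream. It depends on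
-- the stream through the frequencies alone, and each element consumes its own block of `w` random
-- bits; the moment computations are inductions along these blocks.
mass : ∀ w {u} → (Fin u → ℕ) → Vec Bool (u ℕ.* w) → Histogram w
mass w {zero}  f r v = 0
mass w {suc u} f r v = point (f Fin.zero) (take w r) v ℕ.+ mass w (f ∘ Fin.suc) (drop w r) v

mass-cong : ∀ w {u} {f g : Fin u → ℕ} → f ≗ g → ∀ r → mass w f r ≗ mass w g r
mass-cong w {zero}  f≗g r v = refl
mass-cong w {suc u} f≗g r v =
  cong₂ (λ a m → point a (take w r) v ℕ.+ m) (f≗g Fin.zero) (mass-cong w (f≗g ∘ Fin.suc) (drop w r) v)

mass-0 : ∀ w {u} r → mass w {u} (const 0) r ≗ const 0
mass-0 w {zero}  r v = refl
mass-0 w {suc u} r v = cong₂ ℕ._+_ (point-0 (take w r) v) (mass-0 w {u} (drop w r) v)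

-- The link between the online and the offline description: reading `x` raises one frequency by one,
-- which is one `bump` at the hash of `x`.
mass-increment : ∀ w {u} (f : Fin u → ℕ) x r →
  mass w (λ y → bit (does (y Fin.≟ x)) ℕ.+ f y) r ≗ bump (hash w r x) (mass w f r)
mass-increment w f Fin.zero r v =
  trans (cong (ℕ._+ mass w (f ∘ Fin.suc) (drop w r) v) (point-+ 1 (f Fin.zero) (take w r) v))
        (ℕ.+-assoc (point 1 (take w r) v) _ _)
mass-increment w f (Fin.suc x) r v =
  trans (cong (point (f Fin.zero) (take w r) v ℕ.+_) (mass-increment w (f ∘ Fin.suc) x (drop w r) v))
        (swap (point (f Fin.zero) (take w r) v) (point 1 (hash w (drop w r) x) v) _)
  where
  swap : ∀ a b c → a ℕ.+ (b ℕ.+ c) ≡ b ℕ.+ (a ℕ.+ c)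
  swap = solve-∀ ℕ.ring

frequency-∷ : ∀ {u n} x (xs : Stream u n) y →
  frequency (x ∷ xs) y ≡ bit (does (y Fin.≟ x)) ℕ.+ frequency xs y
frequency-∷ x xs y with does (y Fin.≟ x)
... | true  = refl
... | false = refl

module _ (b s w : ℕ) {u : ℕ} where

  countHash : Vec Bool (u ℕ.* w) → Vec Bool s → Fin u → Vec Bool s
  countHash r m x = store b s (bump (hash w r x) (load b w m))

  -- The loop invariant, general in the histogram `p` already stored. Each step raises `total p` by
  -- one and lowers the remaining length by one, so a memory with room for the whole stream holds
  -- every intermediate histogram.
  load-foldl : ∀ {n} r m (p : Histogram w) (xs : Stream u n) → load b w m ≗ p →
    2 ℕ.^ b ℕ.* (2 ℕ.^ w ℕ.* suc b) ℕ.+ (total p ℕ.+ n) ℕ.≤ 2 ℕ.^ b ℕ.* s →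
    load b w (foldl (λ _ → Vec Bool s) (countHash r) m xs) ≗ (λ v → p v ℕ.+ mass w (frequency xs) r v)
  load-foldl r m p [] loaded fits v =
    trans (loaded v) (sym (trans (cong (p v ℕ.+_) (mass-0 w {u} r v)) (ℕ.+-identityʳ (p v))))
  load-foldl {suc n} r m p (x ∷ xs) loaded fits v =
    trans (load-foldl r (countHash r m x) (bump h p) xs loaded′ fits′ v)
      (trans (rearrange (point 1 h v) (p v) (mass w (frequency xs) r v))
        (cong (p v ℕ.+_) (sym (trans (mass-cong w (frequency-∷ x xs) r v)
                                     (mass-increment w (frequency xs) x r v)))))
    where
    h = hash w r x
    rearrange : ∀ a b c → a ℕ.+ b ℕ.+ c ≡ b ℕ.+ (a ℕ.+ c)
    rearrange = solve-∀ ℕ.ring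
    K = 2 ℕ.^ b ℕ.* (2 ℕ.^ w ℕ.* suc b)
    fits′ : K ℕ.+ (total (bump h p) ℕ.+ n) ℕ.≤ 2 ℕ.^ b ℕ.* s
    fits′ = subst (λ k → K ℕ.+ k ℕ.≤ 2 ℕ.^ b ℕ.* s)
      (trans (ℕ.+-suc (total p) n) (cong (ℕ._+ n) (sym (total-bump h p)))) fits
    bumped : bump h (load b w m) ≗ bump h p
    bumped y = cong (point 1 h y ℕ.+_) (loaded y)
    loaded′ : load b w (countHash r m x) ≗ bump h p
    loaded′ y = trans
      (load-store b s (bump h (load b w m))
        (subst (λ k → K ℕ.+ k ℕ.≤ 2 ℕ.^ b ℕ.* s) (sym (total-cong bumped))
          (ℕ.≤-trans (ℕ.+-monoʳ-≤ K (ℕ.m≤m+n _ n)) fits′)) y)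
      (bumped y)

  load-stream : ∀ {n} r (xs : Stream u n) →
    2 ℕ.^ b ℕ.* (2 ℕ.^ w ℕ.* suc b) ℕ.+ n ℕ.≤ 2 ℕ.^ b ℕ.* s →
    load b w (foldl (λ _ → Vec Bool s) (countHash r) (store b s {w} (const 0)) xs) ≗ mass w (frequency xs) r
  load-stream {n} r xs fits = load-foldl r _ (const 0) xs
    (load-store b s (const 0)
      (ℕ.≤-trans (ℕ.+-monoʳ-≤ K (ℕ.≤-trans (ℕ.≤-reflexive (total-0 w)) z≤n)) fits))
    (subst (λ k → K ℕ.+ (k ℕ.+ n) ℕ.≤ 2 ℕ.^ b ℕ.* s) (sym (total-0 w)) fits)
    where K = 2 ℕ.^ b ℕ.* (2 ℕ.^ w ℕ.* suc b)

module Moments where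

  open import Data.Integer.Base using (_+_; _*_; _-_; -_; _≤_; 0ℤ; 1ℤ; -1ℤ)

  -- Sums over bit strings

  Σ : ∀ {m} → (Vec Bool m → ℤ) → ℤ
  Σ {zero}  φ = φ []
  Σ {suc m} φ = Σ (φ ∘ (false ∷_)) + Σ (φ ∘ (true ∷_))

  2^_ : ℕ → ℤ
  2^ m = + (2 ℕ.^ m)

  2^-suc : ∀ m → 2^ suc m ≡ 2^ m + 2^ m
  2^-suc m = trans (cong +_ (cong (2 ℕ.^ m ℕ.+_) (ℕ.+-identityʳ _))) (ℤ.pos-+ (2 ℕ.^ m) _)

  2^-+ : ∀ m n → 2^ (m ℕ.+ n) ≡ 2^ m * 2^ n
  2^-+ m n = trans (cong +_ (ℕ.^-distribˡ-+-* 2 m n)) (ℤ.pos-* (2 ℕ.^ m) _)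

  Σ-cong : ∀ {m} {φ ψ : Vec Bool m → ℤ} → φ ≗ ψ → Σ φ ≡ Σ ψ
  Σ-cong {zero}  φ≗ψ = φ≗ψ []
  Σ-cong {suc m} φ≗ψ = cong₂ _+_ (Σ-cong (φ≗ψ ∘ (false ∷_))) (Σ-cong (φ≗ψ ∘ (true ∷_)))

  Σ-mono : ∀ {m} {φ ψ : Vec Bool m → ℤ} → (∀ r → φ r ≤ ψ r) → Σ φ ≤ Σ ψ
  Σ-mono {zero}  φ≤ψ = φ≤ψ []
  Σ-mono {suc m} φ≤ψ = ℤ.+-mono-≤ (Σ-mono (φ≤ψ ∘ (false ∷_))) (Σ-mono (φ≤ψ ∘ (true ∷_)))

  interchange : ∀ a b c d → a + b + (c + d) ≡ a + c + (b + d)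
  interchange = solve-∀ ℤ.ring

  Σ-+ : ∀ {m} (φ ψ : Vec Bool m → ℤ) → Σ (λ r → φ r + ψ r) ≡ Σ φ + Σ ψ
  Σ-+ {zero}  φ ψ = refl
  Σ-+ {suc m} φ ψ = trans
    (cong₂ _+_ (Σ-+ (φ ∘ (false ∷_)) (ψ ∘ (false ∷_))) (Σ-+ (φ ∘ (true ∷_)) (ψ ∘ (true ∷_))))
    (interchange (Σ (φ ∘ (false ∷_))) (Σ (ψ ∘ (false ∷_))) (Σ (φ ∘ (true ∷_))) (Σ (ψ ∘ (true ∷_))))

  Σ-* : ∀ {m} c (φ : Vec Bool m → ℤ) → Σ (λ r → c * φ r) ≡ c * Σ φ
  Σ-* {zero}  c φ = refl
  Σ-* {suc m} c φ = trans
    (cong₂ _+_ (Σ-* c (φ ∘ (false ∷_))) (Σ-* c (φ ∘ (true ∷_))))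
    (sym (ℤ.*-distribˡ-+ c _ _))

  Σ-const : ∀ m c → Σ {m} (const c) ≡ 2^ m * c
  Σ-const zero    c = sym (ℤ.*-identityˡ c)
  Σ-const (suc m) c = begin
    Σ {m} (const c) + Σ {m} (const c)  ≡⟨ cong₂ _+_ (Σ-const m c) (Σ-const m c) ⟩
    2^ m * c + 2^ m * c                ≡⟨ ℤ.*-distribʳ-+ c (2^ m) (2^ m) ⟨
    (2^ m + 2^ m) * c                  ≡⟨ cong (_* c) (2^-suc m) ⟨
    2^ suc m * c                       ∎
    where open ≡-Reasoning

  Σ-swap : ∀ {m n} (φ : Vec Bool m → Vec Bool n → ℤ) →
    Σ (λ a → Σ (λ b → φ a b)) ≡ Σ (λ b → Σ (λ a → φ a b))
  Σ-swap {zero}  φ = refl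
  Σ-swap {suc m} φ = trans
    (cong₂ _+_ (Σ-swap (φ ∘ (false ∷_))) (Σ-swap (φ ∘ (true ∷_))))
    (sym (Σ-+ (λ b → Σ (λ a → φ (false ∷ a) b)) (λ b → Σ (λ a → φ (true ∷ a) b))))

  Σ-take-drop : ∀ m {n} (φ : Vec Bool m → Vec Bool n → ℤ) →
    Σ (λ r → φ (take m r) (drop m r)) ≡ Σ (λ a → Σ (λ b → φ a b))
  Σ-take-drop zero    φ = refl
  Σ-take-drop (suc m) φ =
    cong₂ _+_ (Σ-take-drop m (φ ∘ (false ∷_))) (Σ-take-drop m (φ ∘ (true ∷_)))

  Σ-affine : ∀ {m} c (φ : Vec Bool m → ℤ) k → Σ (λ r → c * φ r + k) ≡ c * Σ φ + 2^ m * k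
  Σ-affine {m} c φ k = trans (Σ-+ (λ r → c * φ r) (const k)) (cong₂ _+_ (Σ-* c φ) (Σ-const m k))

  -- A hash value consists of a sign bit followed by a bucket.
  Σ-hash : ∀ {t m} (φ : Vec Bool (suc t) → Vec Bool m → ℤ) →
    Σ (λ r → φ (take (suc t) r) (drop (suc t) r)) ≡
    Σ (λ h → Σ (λ b → φ (false ∷ h) b + φ (true ∷ h) b))
  Σ-hash {t} {m} φ = begin
    Σ (λ r → φ (take (suc t) r) (drop (suc t) r))  ≡⟨ Σ-take-drop (suc t) φ ⟩
    Σ (λ h → Σ (φ₀ h)) + Σ (λ h → Σ (φ₁ h))         ≡⟨ Σ-+ (λ h → Σ (φ₀ h)) (λ h → Σ (φ₁ h)) ⟨
    Σ (λ h → Σ (φ₀ h) + Σ (φ₁ h))                   ≡⟨ Σ-cong (λ h → sym (Σ-+ (φ₀ h) (φ₁ h))) ⟩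
    Σ (λ h → Σ (λ b → φ₀ h b + φ₁ h b))             ∎
    where
    open ≡-Reasoning
    φ₀ φ₁ : Vec Bool t → Vec Bool m → ℤ
    φ₀ h = φ (false ∷ h)
    φ₁ h = φ (true ∷ h)

  -- Moments of the sketch

  -- The two unsigned counts of a bucket are combined only when the output is computed, so signs
  -- never affect the stored total.
  difference : ∀ {t} → Histogram (suc t) → Vec Bool t → ℤ
  difference p j = + p (false ∷ j) - + p (true ∷ j)

  energy : ∀ {t} → Histogram (suc t) → ℤ
  energy p = Σ (λ j → difference p j * difference p j)

  energy-cong : ∀ {t} {p q : Histogram (suc t)} → p ≗ q → energy p ≡ energy q
  energy-cong {p = p} {q} p≗q = Σ-cong (λ j → cong (λ d → d * d) (diff j))
    where
    diff : difference p ≗ difference q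
    diff j = cong₂ (λ a b → + a - + b) (p≗q (false ∷ j)) (p≗q (true ∷ j))

  -- Only coordinate `h` changes, so the sum grows by a difference of two squares there. The factor
  -- `c` will be a sign, whose square is 1.
  Σ-square-point : ∀ {t} c a (h : Vec Bool t) (d : Vec Bool t → ℤ) →
    Σ (λ j → (d j + c * + point a h j) * (d j + c * + point a h j)) ≡
    Σ (λ j → d j * d j) + (+ 2 * (c * + a * d h) + c * + a * (c * + a))
  Σ-square-point c a [] d = expand c (+ a) (d [])
    where
    expand : ∀ c a d → (d + c * a) * (d + c * a) ≡ d * d + (+ 2 * (c * a * d) + c * a * (c * a))
    expand = solve-∀ ℤ.ring
  Σ-square-point c a (false ∷ h) d = trans
    (cong₂ _+_ (Σ-square-point c a h (d ∘ (false ∷_)))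
               (Σ-cong (λ j → unmoved c (d (true ∷ j)))))
    (rearrange (Σ (λ j → d (false ∷ j) * d (false ∷ j))) _ (Σ (λ j → d (true ∷ j) * d (true ∷ j))))
    where
    unmoved : ∀ c x → (x + c * 0ℤ) * (x + c * 0ℤ) ≡ x * x
    unmoved = solve-∀ ℤ.ring
    rearrange : ∀ x y z → (x + y) + z ≡ x + z + y
    rearrange = solve-∀ ℤ.ring
  Σ-square-point c a (true ∷ h) d = trans
    (cong₂ _+_ (Σ-cong (λ j → unmoved c (d (false ∷ j))))
               (Σ-square-point c a h (d ∘ (true ∷_))))
    (sym (ℤ.+-assoc (Σ (λ j → d (false ∷ j) * d (false ∷ j))) _ _))
    where
    unmoved : ∀ c x → (x + c * 0ℤ) * (x + c * 0ℤ) ≡ x * x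
    unmoved = solve-∀ ℤ.ring

  sign : Bool → ℤ
  sign false = 1ℤ
  sign true  = -1ℤ

  difference-point : ∀ {t} s a (h : Vec Bool t) p j →
    difference (λ v → point a (s ∷ h) v ℕ.+ p v) j ≡ difference p j + sign s * + point a h j
  difference-point false a h p j
    rewrite ℤ.pos-+ (point a h j) (p (false ∷ j)) = move (+ point a h j) (+ p (false ∷ j)) (+ p (true ∷ j))
    where
    move : ∀ x y z → x + y - z ≡ y - z + 1ℤ * x
    move = solve-∀ ℤ.ring
  difference-point true a h p j
    rewrite ℤ.pos-+ (point a h j) (p (true ∷ j)) = move (+ point a h j) (+ p (false ∷ j)) (+ p (true ∷ j))
    where
    move : ∀ x y z → y - (x + z) ≡ y - z + -1ℤ * x
    move = solve-∀ ℤ.ring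

  energy-point : ∀ {t} s a (h : Vec Bool t) p →
    energy (λ v → point a (s ∷ h) v ℕ.+ p v) ≡
    energy p + (+ 2 * (sign s * + a * difference p h) + sign s * + a * (sign s * + a))
  energy-point s a h p = trans
    (Σ-cong (λ j → cong (λ d → d * d) (difference-point s a h p j)))
    (Σ-square-point (sign s) a h (difference p))

  secondMoment : ∀ {u} → (Fin u → ℕ) → ℕ
  secondMoment f = sum (tabulate λ x → f x ℕ.^ 2)

  pos-^2 : ∀ a → + (a ℕ.^ 2) ≡ + a * + a
  pos-^2 a = trans (cong +_ (cong (a ℕ.*_) (ℕ.*-identityʳ a))) (ℤ.pos-* a a)

  +secondMoment-suc : ∀ {u} (f : Fin (suc u) → ℕ) →
    + secondMoment f ≡ + f Fin.zero * + f Fin.zero + + secondMoment (f ∘ Fin.suc)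
  +secondMoment-suc f = trans (ℤ.pos-+ (f Fin.zero ℕ.^ 2) _) (cong (_+ + secondMoment (f ∘ Fin.suc)) (pos-^2 (f Fin.zero)))

  module Sketch (t : ℕ) where

    estimate : ∀ {u} → (Fin u → ℕ) → Vec Bool (u ℕ.* suc t) → ℤ
    estimate f r = energy (mass (suc t) f r)

    error : ∀ {u} → (Fin u → ℕ) → Vec Bool (u ℕ.* suc t) → ℤ
    error f r = estimate f r - + secondMoment f

    2^-block : ∀ m → 2^ (suc t ℕ.+ m) ≡ + 2 * (2^ t * 2^ m)
    2^-block m = trans (ℤ.pos-* 2 (2 ℕ.^ (t ℕ.+ m))) (cong (+ 2 *_) (2^-+ t m))

    -- Unbiasedness: the two signs of the first element cancel the cross term, leaving `a * a` plus
    -- the estimate for the other elements, which reads a separate block of randomness.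
    Σ-estimate : ∀ {u} (f : Fin u → ℕ) → Σ (estimate f) ≡ 2^ (u ℕ.* suc t) * + secondMoment f
    Σ-estimate {zero} f = trans (Σ-const t 0ℤ) (ℤ.*-zeroʳ (2^ t))
    Σ-estimate {suc u} f = begin
      Σ (estimate f)
        ≡⟨ Σ-hash (λ v b → E v b) ⟩
      Σ (λ h → Σ (λ b → E (false ∷ h) b + E (true ∷ h) b))
        ≡⟨ Σ-cong (λ h → Σ-cong (λ b → pair h b)) ⟩
      Σ {t} (λ h → Σ (λ b → + 2 * estimate f′ b + + 2 * (a * a)))
        ≡⟨ Σ-const t _ ⟩
      2^ t * Σ (λ b → + 2 * estimate f′ b + + 2 * (a * a))
        ≡⟨ cong (2^ t *_) (Σ-affine (+ 2) (estimate f′) _) ⟩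
      2^ t * (+ 2 * Σ (estimate f′) + 2^ m * (+ 2 * (a * a)))
        ≡⟨ cong (λ x → 2^ t * (+ 2 * x + 2^ m * (+ 2 * (a * a)))) (Σ-estimate f′) ⟩
      2^ t * (+ 2 * (2^ m * F′) + 2^ m * (+ 2 * (a * a)))
        ≡⟨ collect (2^ t) (2^ m) F′ a ⟩
      + 2 * (2^ t * 2^ m) * (a * a + F′)
        ≡⟨ cong₂ _*_ (2^-block m) (+secondMoment-suc f) ⟨
      2^ (suc u ℕ.* suc t) * + secondMoment f ∎
      where
      open ≡-Reasoning
      f₀ = f Fin.zero
      f′ = f ∘ Fin.suc
      a = + f₀
      F′ = + secondMoment f′
      m = u ℕ.* suc t
      collect : ∀ T P F a → T * (+ 2 * (P * F) + P * (+ 2 * (a * a))) ≡ + 2 * (T * P) * (a * a + F)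
      collect = solve-∀ ℤ.ring
      cancel : ∀ x a d → x + (+ 2 * (1ℤ * a * d) + 1ℤ * a * (1ℤ * a)) +
        (x + (+ 2 * (-1ℤ * a * d) + -1ℤ * a * (-1ℤ * a))) ≡ + 2 * x + + 2 * (a * a)
      cancel = solve-∀ ℤ.ring
      E : Vec Bool (suc t) → Vec Bool m → ℤ
      E v b = energy (λ y → point f₀ v y ℕ.+ mass (suc t) f′ b y)
      pair : ∀ h b → E (false ∷ h) b + E (true ∷ h) b ≡ + 2 * estimate f′ b + + 2 * (a * a)
      pair h b = trans
        (cong₂ _+_ (energy-point false f₀ h (mass (suc t) f′ b)) (energy-point true f₀ h (mass (suc t) f′ b)))
        (cancel (estimate f′ b) a (difference (mass (suc t) f′ b) h))

    -- Subtracting the true moment removes `a * a`, so the error moves by `2 a d` up or down and its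
    -- mixed term cancels over the two signs. Summing `d * d` over the buckets `h` gives the
    -- estimate for the remaining elements, whose sum over the random strings is known from
    -- `Σ-estimate`.
    Σ-error²-suc : ∀ {u} (f : Fin (suc u) → ℕ) →
      let f′ = f ∘ Fin.suc ; a = + f Fin.zero in
      Σ (λ r → error f r * error f r) ≡
      + 2 * 2^ t * Σ (λ r → error f′ r * error f′ r) + + 8 * (a * a) * (2^ (u ℕ.* suc t) * + secondMoment f′)
    Σ-error²-suc {u} f = begin
      Σ (λ r → error f r * error f r)
        ≡⟨ Σ-hash (λ v b → E v b) ⟩
      Σ (λ h → Σ (λ b → E (false ∷ h) b + E (true ∷ h) b))
        ≡⟨ Σ-cong (λ h → trans (Σ-cong (λ b → pair h b)) (Σ-+ (λ b → + 2 * e² b) (λ b → + 8 * (a * a) * d² h b))) ⟩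
      Σ (λ h → Σ (λ b → + 2 * e² b) + Σ (λ b → + 8 * (a * a) * d² h b))
        ≡⟨ Σ-+ (λ h → Σ (λ b → + 2 * e² b)) (λ h → Σ (λ b → + 8 * (a * a) * d² h b)) ⟩
      Σ {t} (λ h → Σ (λ b → + 2 * e² b)) + Σ (λ h → Σ (λ b → + 8 * (a * a) * d² h b))
        ≡⟨ cong₂ _+_ (Σ-const t _) (Σ-swap (λ h b → + 8 * (a * a) * d² h b)) ⟩
      2^ t * Σ (λ b → + 2 * e² b) + Σ (λ b → Σ (λ h → + 8 * (a * a) * d² h b))
        ≡⟨ cong₂ (λ x y → 2^ t * x + y) (Σ-* (+ 2) e²)
             (trans (Σ-cong (λ b → Σ-* (+ 8 * (a * a)) (λ h → d² h b))) (Σ-* (+ 8 * (a * a)) (estimate f′))) ⟩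
      2^ t * (+ 2 * Σ e²) + + 8 * (a * a) * Σ (estimate f′)
        ≡⟨ cong₂ (λ x y → x + + 8 * (a * a) * y) (reassoc (2^ t) (Σ e²)) (Σ-estimate f′) ⟩
      + 2 * 2^ t * Σ e² + + 8 * (a * a) * (2^ (u ℕ.* suc t) * + secondMoment f′) ∎
      where
      open ≡-Reasoning
      f₀ = f Fin.zero
      f′ = f ∘ Fin.suc
      a = + f₀
      square : ℤ → ℤ
      square x = x * x
      e² : Vec Bool (u ℕ.* suc t) → ℤ
      e² b = error f′ b * error f′ b
      d² : Vec Bool t → Vec Bool (u ℕ.* suc t) → ℤ
      d² h b = square (difference (mass (suc t) f′ b) h)
      reassoc : ∀ x y → x * (+ 2 * y) ≡ + 2 * x * y
      reassoc = solve-∀ ℤ.ring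
      -- the parallelogram law
      cancel : ∀ x a d F →
        (x + (+ 2 * (1ℤ * a * d) + 1ℤ * a * (1ℤ * a)) - (a * a + F)) *
        (x + (+ 2 * (1ℤ * a * d) + 1ℤ * a * (1ℤ * a)) - (a * a + F)) +
        (x + (+ 2 * (-1ℤ * a * d) + -1ℤ * a * (-1ℤ * a)) - (a * a + F)) *
        (x + (+ 2 * (-1ℤ * a * d) + -1ℤ * a * (-1ℤ * a)) - (a * a + F)) ≡
        + 2 * ((x - F) * (x - F)) + + 8 * (a * a) * (d * d)
      cancel = solve-∀ ℤ.ring
      E : Vec Bool (suc t) → Vec Bool (u ℕ.* suc t) → ℤ
      E v b = square (energy (λ y → point f₀ v y ℕ.+ mass (suc t) f′ b y) - + secondMoment f)
      pair : ∀ h b → E (false ∷ h) b + E (true ∷ h) b ≡ + 2 * e² b + + 8 * (a * a) * d² h b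
      pair h b = trans
        (cong₂ (λ x y → square x + square y)
          (cong₂ _-_ (energy-point false f₀ h (mass (suc t) f′ b)) (+secondMoment-suc f))
          (cong₂ _-_ (energy-point true f₀ h (mass (suc t) f′ b)) (+secondMoment-suc f)))
        (cancel (estimate f′ b) a (difference (mass (suc t) f′ b) h) (+ secondMoment f′))

    -- With `2 ^ t` buckets this says that the variance is at most `2 F² / 2 ^ t`. The induction
    -- needs `2 F′² + 4 a² F′ ≤ 2 (a² + F′)²`.
    Σ-error² : ∀ {u} (f : Fin u → ℕ) →
      2^ t * Σ (λ r → error f r * error f r) ≤ + 2 * 2^ (u ℕ.* suc t) * (+ secondMoment f * + secondMoment f)
    Σ-error² {zero} f = ℤ.≤-reflexive (trans (cong (2^ t *_) (cong (λ x → (x - 0ℤ) * (x - 0ℤ))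
      (trans (Σ-const t 0ℤ) (ℤ.*-zeroʳ (2^ t))))) (ℤ.*-zeroʳ (2^ t)))
    Σ-error² {suc u} f = begin
      2^ t * Σ (λ r → error f r * error f r)
        ≡⟨ cong (2^ t *_) (Σ-error²-suc f) ⟩
      2^ t * (+ 2 * 2^ t * V + + 8 * (a * a) * (2^ m * F′))
        ≡⟨ left (2^ t) (2^ m) V a F′ ⟩
      + 2 * 2^ t * (2^ t * V) + + 8 * (a * a) * (2^ t * 2^ m * F′)
        ≤⟨ ℤ.+-monoˡ-≤ _ (ℤ.*-monoˡ-≤-nonNeg (+ 2 * 2^ t) {{nonNeg}} (Σ-error² f′)) ⟩
      + 2 * 2^ t * (+ 2 * 2^ m * (F′ * F′)) + + 8 * (a * a) * (2^ t * 2^ m * F′)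
        -- The term that completes the square, `2 a⁴` per random string; as the image of a natural
        -- number it is visibly nonnegative.
        ≤⟨ ℤ.i≤i+j _ (+ (4 ℕ.* (2 ℕ.^ t ℕ.* 2 ℕ.^ m) ℕ.* ((f₀ ℕ.* f₀) ℕ.* (f₀ ℕ.* f₀)))) ⟩
      + 2 * 2^ t * (+ 2 * 2^ m * (F′ * F′)) + + 8 * (a * a) * (2^ t * 2^ m * F′) +
        + (4 ℕ.* (2 ℕ.^ t ℕ.* 2 ℕ.^ m) ℕ.* ((f₀ ℕ.* f₀) ℕ.* (f₀ ℕ.* f₀)))
        ≡⟨ cong (λ x → + 2 * 2^ t * (+ 2 * 2^ m * (F′ * F′)) + + 8 * (a * a) * (2^ t * 2^ m * F′) + x) cast ⟩
      + 2 * 2^ t * (+ 2 * 2^ m * (F′ * F′)) + + 8 * (a * a) * (2^ t * 2^ m * F′) +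
        + 4 * (2^ t * 2^ m) * ((a * a) * (a * a))
        ≡⟨ right (2^ t) (2^ m) a F′ ⟩
      + 2 * (+ 2 * (2^ t * 2^ m)) * ((a * a + F′) * (a * a + F′))
        ≡⟨ cong₂ (λ x y → + 2 * x * (y * y)) (2^-block m) (+secondMoment-suc f) ⟨
      + 2 * 2^ (suc u ℕ.* suc t) * (+ secondMoment f * + secondMoment f) ∎
      where
      open ℤ.≤-Reasoning
      f₀ = f Fin.zero
      f′ = f ∘ Fin.suc
      a = + f₀
      F′ = + secondMoment f′
      m = u ℕ.* suc t
      V = Σ (λ r → error f′ r * error f′ r)
      nonNeg : ℤ.NonNegative (+ 2 * 2^ t)
      nonNeg = subst ℤ.NonNegative (ℤ.pos-* 2 (2 ℕ.^ t)) _
      left : ∀ T P V a F → T * (+ 2 * T * V + + 8 * (a * a) * (P * F)) ≡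
        + 2 * T * (T * V) + + 8 * (a * a) * (T * P * F)
      left = solve-∀ ℤ.ring
      right : ∀ T P a F → + 2 * T * (+ 2 * P * (F * F)) + + 8 * (a * a) * (T * P * F) +
        + 4 * (T * P) * ((a * a) * (a * a)) ≡ + 2 * (+ 2 * (T * P)) * ((a * a + F) * (a * a + F))
      right = solve-∀ ℤ.ring
      cast : + (4 ℕ.* (2 ℕ.^ t ℕ.* 2 ℕ.^ m) ℕ.* ((f₀ ℕ.* f₀) ℕ.* (f₀ ℕ.* f₀))) ≡
        + 4 * (2^ t * 2^ m) * ((a * a) * (a * a))
      cast = trans (ℤ.pos-* (4 ℕ.* (2 ℕ.^ t ℕ.* 2 ℕ.^ m)) _) (cong₂ _*_
        (trans (ℤ.pos-* 4 (2 ℕ.^ t ℕ.* 2 ℕ.^ m)) (cong (+ 4 *_) (ℤ.pos-* (2 ℕ.^ t) (2 ℕ.^ m))))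
        (trans (ℤ.pos-* (f₀ ℕ.* f₀) _) (cong₂ _*_ (ℤ.pos-* f₀ f₀) (ℤ.pos-* f₀ f₀))))

  -- Chebyshev's inequality

  #-Σ : ∀ {ℓ} (E : Vec Bool ℓ → Bool) → + (# E) ≡ Σ (λ r → + bit (E r))
  #-Σ {zero}  E = refl
  #-Σ {suc ℓ} E = trans (ℤ.pos-+ (# (E ∘ (false ∷_))) _)
    (cong₂ _+_ (#-Σ (E ∘ (false ∷_))) (#-Σ (E ∘ (true ∷_))))

  +∣i∣² : ∀ i → + ℤ.∣ i ∣ * + ℤ.∣ i ∣ ≡ i * i
  +∣i∣² (+ n)        = refl
  +∣i∣² (ℤ.-[1+ n ]) = refl

  near : ℕ → ℕ → ℤ → Bool
  near e F x = does (2 ℕ.^ e ℕ.* ℤ.∣ x ∣ ℕ.≤? F)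

  -- The threshold F * F + 1 in place of F * F makes the case F = 0 unexceptional.
  far-≤ : ∀ e F x (near? : Dec (2 ℕ.^ e ℕ.* ℤ.∣ x ∣ ℕ.≤ F)) →
    + suc (F ℕ.* F) ≤ 2^ e * 2^ e * (x * x) + + suc (F ℕ.* F) * + bit (does near?)
  far-≤ e F x (yes _) = begin
    + S                                              ≡⟨ ℤ.*-identityʳ (+ S) ⟨
    + S * 1ℤ                                         ≤⟨ ℤ.i≤j+i _ (+ (2 ℕ.^ e ℕ.* 2 ℕ.^ e ℕ.* (ℤ.∣ x ∣ ℕ.* ℤ.∣ x ∣))) ⟩
    + (2 ℕ.^ e ℕ.* 2 ℕ.^ e ℕ.* (ℤ.∣ x ∣ ℕ.* ℤ.∣ x ∣)) + + S * 1ℤ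
      ≡⟨ cong (_+ + S * 1ℤ) (trans (ℤ.pos-* (2 ℕ.^ e ℕ.* 2 ℕ.^ e) _)
           (cong₂ _*_ (ℤ.pos-* (2 ℕ.^ e) _) (trans (ℤ.pos-* ℤ.∣ x ∣ _) (+∣i∣² x)))) ⟩
    2^ e * 2^ e * (x * x) + + S * 1ℤ                 ∎
    where
    open ℤ.≤-Reasoning
    S = suc (F ℕ.* F)
  far-≤ e F x (no far) = begin
    + S                                              ≤⟨ ℤ.+≤+ (ℕ.*-mono-< (ℕ.≰⇒> far) (ℕ.≰⇒> far)) ⟩
    + (y ℕ.* y)                                      ≡⟨ ℤ.pos-* y y ⟩
    + y * + y                                        ≡⟨ cong₂ _*_ (ℤ.pos-* (2 ℕ.^ e) ℤ.∣ x ∣) (ℤ.pos-* (2 ℕ.^ e) ℤ.∣ x ∣) ⟩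
    2^ e * + ℤ.∣ x ∣ * (2^ e * + ℤ.∣ x ∣)            ≡⟨ regroup (2^ e) (+ ℤ.∣ x ∣) (+ S) ⟩
    2^ e * 2^ e * (+ ℤ.∣ x ∣ * + ℤ.∣ x ∣) + + S * 0ℤ ≡⟨ cong (λ z → 2^ e * 2^ e * z + + S * 0ℤ) (+∣i∣² x) ⟩
    2^ e * 2^ e * (x * x) + + S * 0ℤ                 ∎
    where
    open ℤ.≤-Reasoning
    S = suc (F ℕ.* F)
    y = 2 ℕ.^ e ℕ.* ℤ.∣ x ∣
    regroup : ∀ a b c → a * b * (a * b) ≡ a * a * (b * b) + c * 0ℤ
    regroup = solve-∀ ℤ.ring

  -- Summing `far-≤` over all random strings is Markov's inequality for the square. Multiplying by 8
  -- turns `Q` into the factor in `bound`; then `F * F ≤ S` leaves `6 * 2 ^ ℓ * S ≤ 8 * S * N`, and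
  -- the positive `S` cancels, even for `F = 0`.
  chebyshev : ∀ e {ℓ} F (X : Vec Bool ℓ → ℤ) →
    2^ (3 ℕ.+ (e ℕ.+ e)) * Σ (λ r → X r * X r) ≤ + 2 * 2^ ℓ * (+ F * + F) →
    3 ℕ.* 2 ℕ.^ ℓ ℕ.≤ 4 ℕ.* # (near e F ∘ X)
  chebyshev e {ℓ} F X bound =
    ℤ.drop‿+≤+ (subst₂ _≤_ (sym (ℤ.pos-* 3 (2 ℕ.^ ℓ))) (sym (ℤ.pos-* 4 N))
      (ℤ.*-cancelʳ-≤-pos _ _ (+ (2 ℕ.* suc (F ℕ.* F))) doubled))
    where
    open ℤ.≤-Reasoning
    N = # (near e F ∘ X)
    S Q V : ℤ
    S = + suc (F ℕ.* F)
    Q = 2^ e * 2^ e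
    V = Σ (λ r → X r * X r)
    summed : 2^ ℓ * S ≤ Q * V + S * + N
    summed = begin
      2^ ℓ * S  ≡⟨ Σ-const ℓ S ⟨
      Σ {ℓ} (const S) ≤⟨ Σ-mono (λ r → far-≤ e F (X r) (_ ℕ.≤? F)) ⟩
      Σ (λ r → Q * (X r * X r) + S * + bit (near e F (X r)))
        ≡⟨ Σ-+ (λ r → Q * (X r * X r)) (λ r → S * + bit (near e F (X r))) ⟩
      Σ (λ r → Q * (X r * X r)) + Σ (λ r → S * + bit (near e F (X r)))
        ≡⟨ cong₂ _+_ (Σ-* Q (λ r → X r * X r)) (Σ-* S (λ r → + bit (near e F (X r)))) ⟩
      Q * V + S * Σ (λ r → + bit (near e F (X r)))
        ≡⟨ cong (λ x → Q * V + S * x) (#-Σ (near e F ∘ X)) ⟨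
      Q * V + S * + N ∎
    8Q : 2^ (3 ℕ.+ (e ℕ.+ e)) ≡ + 8 * Q
    8Q = trans (2^-+ 3 (e ℕ.+ e)) (cong (+ 8 *_) (2^-+ e e))
    S≡ : S ≡ 1ℤ + + F * + F
    S≡ = trans (ℤ.pos-+ 1 (F ℕ.* F)) (cong (λ x → 1ℤ + x) (ℤ.pos-* F F))
    2S≡ : + (2 ℕ.* suc (F ℕ.* F)) ≡ + 2 * S
    2S≡ = ℤ.pos-* 2 (suc (F ℕ.* F))
    expand : ∀ Q V S N → + 8 * (Q * V + S * N) ≡ + 8 * Q * V + + 8 * (S * N)
    expand = solve-∀ ℤ.ring
    eight : + 8 * (2^ ℓ * S) ≤ + 2 * 2^ ℓ * S + + 8 * (S * + N)
    eight = begin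
      + 8 * (2^ ℓ * S)                                ≤⟨ ℤ.*-monoˡ-≤-nonNeg (+ 8) summed ⟩
      + 8 * (Q * V + S * + N)                         ≡⟨ expand Q V S (+ N) ⟩
      + 8 * Q * V + + 8 * (S * + N)                   ≡⟨ cong (λ x → x * V + + 8 * (S * + N)) 8Q ⟨
      2^ (3 ℕ.+ (e ℕ.+ e)) * V + + 8 * (S * + N)      ≤⟨ ℤ.+-monoˡ-≤ (+ 8 * (S * + N)) bound ⟩
      + 2 * 2^ ℓ * (+ F * + F) + + 8 * (S * + N)
        ≤⟨ ℤ.+-monoˡ-≤ (+ 8 * (S * + N)) (ℤ.*-monoˡ-≤-nonNeg (+ 2 * 2^ ℓ) {{subst ℤ.NonNegative (ℤ.pos-* 2 (2 ℕ.^ ℓ)) _}}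
             (ℤ.≤-trans (ℤ.i≤j+i (+ F * + F) 1ℤ) (ℤ.≤-reflexive (sym S≡)))) ⟩
      + 2 * 2^ ℓ * S + + 8 * (S * + N) ∎
    doubled : + 3 * 2^ ℓ * + (2 ℕ.* suc (F ℕ.* F)) ≤ + 4 * + N * + (2 ℕ.* suc (F ℕ.* F))
    doubled = begin
      + 3 * 2^ ℓ * + (2 ℕ.* suc (F ℕ.* F))            ≡⟨ cong (+ 3 * 2^ ℓ *_) 2S≡ ⟩
      + 3 * 2^ ℓ * (+ 2 * S)                          ≡⟨ left (2^ ℓ) S ⟩
      + 8 * (2^ ℓ * S) - + 2 * 2^ ℓ * S               ≤⟨ ℤ.+-monoˡ-≤ (- (+ 2 * 2^ ℓ * S)) eight ⟩
      + 2 * 2^ ℓ * S + + 8 * (S * + N) - + 2 * 2^ ℓ * S ≡⟨ right (2^ ℓ) S (+ N) ⟩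
      + 4 * + N * (+ 2 * S)                           ≡⟨ cong (+ 4 * + N *_) 2S≡ ⟨
      + 4 * + N * + (2 ℕ.* suc (F ℕ.* F))             ∎
      where
      left : ∀ L S → + 3 * L * (+ 2 * S) ≡ + 8 * (L * S) - + 2 * L * S
      left = solve-∀ ℤ.ring
      right : ∀ L S N → + 2 * L * S + + 8 * (S * N) - + 2 * L * S ≡ + 4 * N * (+ 2 * S)
      right = solve-∀ ℤ.ring

  /-mono-< : ∀ i m j n .{{_ : ℕ.NonZero m}} .{{_ : ℕ.NonZero n}} →
    i * + n ℤ.< j * + m → i ℚ./ m ℚ.< j ℚ./ n
  /-mono-< i (suc m) j (suc n) lt = ℚ.toℚᵘ-cancel-<
    (ℚᵘ.<-respˡ-≃ (ℚᵘ.≃-sym (ℚ.toℚᵘ-fromℚᵘ (ℚᵘ.mkℚᵘ i m)))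
      (ℚᵘ.<-respʳ-≃ (ℚᵘ.≃-sym (ℚ.toℚᵘ-fromℚᵘ (ℚᵘ.mkℚᵘ j n))) (ℚᵘ.*<* lt)))

  2/3<Pr : ∀ {ℓ} (E : Vec Bool ℓ → Bool) → 3 ℕ.* 2 ℕ.^ ℓ ℕ.≤ 4 ℕ.* # E → + 2 ℚ./ 3 ℚ.< Pr E
  2/3<Pr {ℓ} E large = /-mono-< (+ 2) 3 (+ (# E)) (2 ℕ.^ ℓ)
    (subst₂ ℤ._<_ (ℤ.pos-* 2 (2 ℕ.^ ℓ)) (ℤ.pos-* (# E) 3) (ℤ.+<+ (ℕ.*-cancelˡ-< 4 (2 ℕ.* L) (# E ℕ.* 3) scaled)))
    where
    instance _ = ℕ.m^n≢0 2 ℓ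
    L = 2 ℕ.^ ℓ
    open ℕ.≤-Reasoning
    scaled : 4 ℕ.* (2 ℕ.* L) ℕ.< 4 ℕ.* (# E ℕ.* 3)
    scaled = begin-strict
      4 ℕ.* (2 ℕ.* L)     ≡⟨ ℕ.*-assoc 4 2 L ⟨
      -- `2/3 < 3/4` in the form `8 < 9`.
      8 ℕ.* L             <⟨ ℕ.*-monoˡ-< L (ℕ.n<1+n 8) ⟩
      9 ℕ.* L             ≡⟨ ℕ.*-assoc 3 3 L ⟩
      3 ℕ.* (3 ℕ.* L)     ≤⟨ ℕ.*-monoʳ-≤ 3 large ⟩
      3 ℕ.* (4 ℕ.* # E)   ≡⟨ ℕ.*-comm 3 (4 ℕ.* # E) ⟩
      4 ℕ.* # E ℕ.* 3     ≡⟨ ℕ.*-assoc 4 (# E) 3 ⟩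
      4 ℕ.* (# E ℕ.* 3)   ∎

open Moments

module Reals where

  open import Data.Rational.Base using (_+_; _*_; _-_; -_; _≤_; _<_; 0ℚ; 1ℚ; ½)
  open Power ℚ.+-*-rawSemiring using (_^_)

  ℚ-ring : AlmostCommutativeRing 0ℓ 0ℓ
  ℚ-ring = fromCommutativeRing ℚ.+-*-commutativeRing (λ p → dec⇒maybe (0ℚ ℚ.≟ p))

  -- Ordered field arithmetic in ℚ

  <-gap : ∀ {p q} r → 0ℚ < r → p + r ≡ q → p < q
  <-gap {p} {q} r 0<r eq = begin-strict
    p       ≡⟨ ℚ.+-identityʳ p ⟨
    p + 0ℚ  <⟨ ℚ.+-monoʳ-< p 0<r ⟩
    p + r   ≡⟨ eq ⟩
    q       ∎
    where open ℚ.≤-Reasoning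

  ≤-gap : ∀ {p q} r → 0ℚ ≤ r → p + r ≡ q → p ≤ q
  ≤-gap {p} {q} r 0≤r eq = begin
    p       ≡⟨ ℚ.+-identityʳ p ⟨
    p + 0ℚ  ≤⟨ ℚ.+-monoʳ-≤ p 0≤r ⟩
    p + r   ≡⟨ eq ⟩
    q       ∎
    where open ℚ.≤-Reasoning

  p<q⇒0<q-p : ∀ {p q} → p < q → 0ℚ < q - p
  p<q⇒0<q-p {p} {q} p<q = subst (_< q - p) (ℚ.+-inverseʳ p) (ℚ.+-monoˡ-< (- p) p<q)

  *-monoʳ-≤ : ∀ {r p q} → 0ℚ ≤ r → p ≤ q → r * p ≤ r * q
  *-monoʳ-≤ {r} 0≤r = ℚ.*-monoˡ-≤-nonNeg r {{ℚ.nonNegative 0≤r}}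

  *-monoˡ-≤ : ∀ {r p q} → 0ℚ ≤ r → p ≤ q → p * r ≤ q * r
  *-monoˡ-≤ {r} 0≤r = ℚ.*-monoʳ-≤-nonNeg r {{ℚ.nonNegative 0≤r}}

  *-mono-≤ : ∀ {p q r s} → 0ℚ ≤ p → 0ℚ ≤ r → p ≤ q → r ≤ s → p * r ≤ q * s
  *-mono-≤ 0≤p 0≤r p≤q r≤s =
    ℚ.≤-trans (*-monoˡ-≤ 0≤r p≤q) (*-monoʳ-≤ (ℚ.≤-trans 0≤p p≤q) r≤s)

  *-monoˡ-< : ∀ {r p q} → 0ℚ < r → p < q → p * r < q * r
  *-monoˡ-< {r} 0<r = ℚ.*-monoˡ-<-pos r {{ℚ.positive 0<r}}

  0<p*q : ∀ {p q} → 0ℚ < p → 0ℚ < q → 0ℚ < p * q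
  0<p*q {p} {q} 0<p 0<q = subst (_< p * q) (ℚ.*-zeroˡ q) (*-monoˡ-< 0<q 0<p)

  0≤p*q : ∀ {p q} → 0ℚ ≤ p → 0ℚ ≤ q → 0ℚ ≤ p * q
  0≤p*q {p} {q} 0≤p 0≤q = subst (_≤ p * q) (ℚ.*-zeroˡ q) (*-monoˡ-≤ 0≤q 0≤p)

  *-cancelʳ-< : ∀ {r p q} → 0ℚ < r → p * r < q * r → p < q
  *-cancelʳ-< {r} 0<r = ℚ.*-cancelʳ-<-nonNeg r {{ℚ.nonNegative (ℚ.<⇒≤ 0<r)}}

  -- Integers and powers of two in ℚ

  ι : ℤ → ℚ
  ι i = i ℚ./ 1

  toℚᵘ-ι : ∀ i → ℚ.toℚᵘ (ι i) ℚᵘ.≃ ℚᵘ.mkℚᵘ i 0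
  toℚᵘ-ι i = ℚ.toℚᵘ-fromℚᵘ (ℚᵘ.mkℚᵘ i 0)

  ι-+ : ∀ i j → ι (i ℤ.+ j) ≡ ι i + ι j
  ι-+ i j = ℚ.toℚᵘ-injective (begin
    ℚ.toℚᵘ (ι (i ℤ.+ j))              ≈⟨ toℚᵘ-ι (i ℤ.+ j) ⟩
    ℚᵘ.mkℚᵘ (i ℤ.+ j) 0               ≈⟨ ℚᵘ.*≡* (integral i j) ⟩
    ℚᵘ.mkℚᵘ i 0 ℚᵘ.+ ℚᵘ.mkℚᵘ j 0      ≈⟨ ℚᵘ.+-cong (toℚᵘ-ι i) (toℚᵘ-ι j) ⟨
    ℚ.toℚᵘ (ι i) ℚᵘ.+ ℚ.toℚᵘ (ι j)    ≈⟨ ℚ.toℚᵘ-homo-+ (ι i) (ι j) ⟨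
    ℚ.toℚᵘ (ι i + ι j)                ∎)
    where
    open ℚᵘ.≃-Reasoning
    integral : ∀ i j → (i ℤ.+ j) ℤ.* (+ 1 ℤ.* + 1) ≡ (i ℤ.* + 1 ℤ.+ j ℤ.* + 1) ℤ.* + 1
    integral = solve-∀ ℤ.ring

  ι-* : ∀ i j → ι (i ℤ.* j) ≡ ι i * ι j
  ι-* i j = ℚ.toℚᵘ-injective (begin
    ℚ.toℚᵘ (ι (i ℤ.* j))              ≈⟨ toℚᵘ-ι (i ℤ.* j) ⟩
    ℚᵘ.mkℚᵘ i 0 ℚᵘ.* ℚᵘ.mkℚᵘ j 0      ≈⟨ ℚᵘ.*-cong (toℚᵘ-ι i) (toℚᵘ-ι j) ⟨
    ℚ.toℚᵘ (ι i) ℚᵘ.* ℚ.toℚᵘ (ι j)    ≈⟨ ℚ.toℚᵘ-homo-* (ι i) (ι j) ⟨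
    ℚ.toℚᵘ (ι i * ι j)                ∎)
    where open ℚᵘ.≃-Reasoning

  ι-mono-< : ∀ {i j} → i ℤ.< j → ι i < ι j
  ι-mono-< {i} {j} i<j = /-mono-< i 1 j 1 (subst₂ ℤ._<_ (sym (ℤ.*-identityʳ i)) (sym (ℤ.*-identityʳ j)) i<j)

  ι-mono-≤ : ∀ {i j} → i ℤ.≤ j → ι i ≤ ι j
  ι-mono-≤ {i} {j} i≤j with i ℤ.≟ j
  ... | yes refl = ℚ.≤-refl
  ... | no i≢j   = ℚ.<⇒≤ (ι-mono-< (ℤ.≤∧≢⇒< i≤j i≢j))

  ν : ℕ → ℚ
  ν n = ι (+ n)

  ν-+ : ∀ m n → ν (m ℕ.+ n) ≡ ν m + ν n
  ν-+ m n = trans (cong ι (ℤ.pos-+ m n)) (ι-+ (+ m) (+ n))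

  ν-* : ∀ m n → ν (m ℕ.* n) ≡ ν m * ν n
  ν-* m n = trans (cong ι (ℤ.pos-* m n)) (ι-* (+ m) (+ n))

  ν-mono-≤ : ∀ {m n} → m ℕ.≤ n → ν m ≤ ν n
  ν-mono-≤ {m} {n} m≤n = ι-mono-≤ {+ m} {+ n} (ℤ.+≤+ m≤n)

  ν-mono-< : ∀ {m n} → m ℕ.< n → ν m < ν n
  ν-mono-< {m} {n} m<n = ι-mono-< {+ m} {+ n} (ℤ.+<+ m<n)

  0≤ν : ∀ n → 0ℚ ≤ ν n
  0≤ν n = ν-mono-≤ {0} {n} z≤n

  -- The division in `ν n` normalises by a gcd that is stuck on a variable. This form exposes the
  -- numerator `n` and the denominator 1, which `log₂` inspects.
  ν≡mkℚ : ∀ n → ν n ≡ mkℚ (+ n) 0 (ℕ.sym (ℕ.1-coprimeTo n))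
  ν≡mkℚ n = ℚ.normalize-coprime (ℕ.sym (ℕ.1-coprimeTo n))

  p*↧p≡↥p : ∀ p → p * ν (↧ₙ p) ≡ ι (↥ p)
  p*↧p≡↥p p@(mkℚ n d _) = ℚ.toℚᵘ-injective (begin
    ℚ.toℚᵘ (p * ν (suc d))                  ≈⟨ ℚ.toℚᵘ-homo-* p (ν (suc d)) ⟩
    ℚᵘ.mkℚᵘ n d ℚᵘ.* ℚ.toℚᵘ (ν (suc d))     ≈⟨ ℚᵘ.*-cong (ℚᵘ.≃-refl {ℚᵘ.mkℚᵘ n d}) (toℚᵘ-ι (+ suc d)) ⟩
    ℚᵘ.mkℚᵘ n d ℚᵘ.* ℚᵘ.mkℚᵘ (+ suc d) 0    ≈⟨ ℚᵘ.*≡* cross ⟩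
    ℚᵘ.mkℚᵘ n 0                             ≈⟨ toℚᵘ-ι n ⟨
    ℚ.toℚᵘ (ι n)                            ∎)
    where
    open ℚᵘ.≃-Reasoning
    cross : n ℤ.* + suc d ℤ.* + 1 ≡ n ℤ.* + suc (d ℕ.* 1)
    cross = trans (ℤ.*-identityʳ (n ℤ.* + suc d)) (cong (λ x → n ℤ.* + suc x) (sym (ℕ.*-identityʳ d)))

  ½^e*2^e≡1 : ∀ e → ½ ^ e * ν (2 ℕ.^ e) ≡ 1ℚ
  ½^e*2^e≡1 zero    = refl
  ½^e*2^e≡1 (suc e) = begin
    ½ * ½ ^ e * ν (2 ℕ.* 2 ℕ.^ e)       ≡⟨ cong (½ * ½ ^ e *_) (ν-* 2 (2 ℕ.^ e)) ⟩
    ½ * ½ ^ e * (ν 2 * ν (2 ℕ.^ e))     ≡⟨ regroup (½ ^ e) (ν (2 ℕ.^ e)) ⟩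
    ½ ^ e * ν (2 ℕ.^ e)                 ≡⟨ ½^e*2^e≡1 e ⟩
    1ℚ                                  ∎
    where
    open ≡-Reasoning
    regroup : ∀ x y → ½ * x * (ν 2 * y) ≡ x * y
    regroup = solve-∀ ℚ-ring

  0<½^ : ∀ e → 0ℚ < ½ ^ e
  0<½^ zero    = ν-mono-< {0} {1} (s≤s z≤n)
  0<½^ (suc e) = 0<p*q {½} (ℚ.positive⁻¹ ½) (0<½^ e)

  ½^≤1 : ∀ e → ½ ^ e ≤ 1ℚ
  ½^≤1 zero    = ℚ.≤-refl
  ½^≤1 (suc e) = *-mono-≤ {½} {1ℚ} (ℚ.nonNegative⁻¹ ½) (ℚ.<⇒≤ (0<½^ e)) (ℚ.≤ᵇ⇒≤ _) (½^≤1 e)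

  n<2^n : ∀ n → n ℕ.< 2 ℕ.^ n
  n<2^n zero    = s≤s z≤n
  n<2^n (suc n) = begin-strict
    suc n                       <⟨ s≤s (n<2^n n) ⟩
    1 ℕ.+ 2 ℕ.^ n               ≤⟨ ℕ.+-mono-≤ (ℕ.m^n>0 2 n) (ℕ.m≤m+n (2 ℕ.^ n) 0) ⟩
    2 ℕ.* 2 ℕ.^ n               ∎
    where open ℕ.≤-Reasoning

  pow2-+ : ∀ m → pow2 (+ m) ≡ ν (2 ℕ.^ m)
  pow2-+ zero    = refl
  pow2-+ (suc m) = trans (cong (ν 2 *_) (pow2-+ m)) (sym (ν-* 2 (2 ℕ.^ m)))

  -- A positive fraction with denominator `d` is at least `1 / d`, and `d < 2 ^ d`. This gives the
  -- dyadic search its bound.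
  ½^↧<p : ∀ {p} → 0ℚ < p → ½ ^ ↧ₙ p < p
  ½^↧<p {p@(mkℚ (+ zero) _ _)} (ℚ.*<* (ℤ.+<+ ()))
  ½^↧<p {p@(mkℚ ℤ.-[1+ _ ] _ _)} (ℚ.*<* ())
  ½^↧<p {p@(mkℚ ℤ.+[1+ m ] d-1 _)} 0<p = *-cancelʳ-< 0<2^d (begin-strict
    ½ ^ d * ν (2 ℕ.^ d)  ≡⟨ ½^e*2^e≡1 d ⟩
    ν 1                  ≤⟨ ν-mono-≤ {1} {suc m} (s≤s z≤n) ⟩
    ν (suc m)            ≡⟨ p*↧p≡↥p p ⟨
    p * ν d              <⟨ ℚ.*-monoʳ-<-pos p {{ℚ.positive 0<p}} (ν-mono-< {d} {2 ℕ.^ d} (n<2^n d)) ⟩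
    p * ν (2 ℕ.^ d)      ∎)
    where
    open ℚ.≤-Reasoning
    d = suc d-1
    0<2^d : 0ℚ < ν (2 ℕ.^ d)
    0<2^d = ν-mono-< {0} {2 ℕ.^ d} (ℕ.m^n>0 2 d)

  -- Cuts

  fromℚ-isReal : ∀ p → IsReal (fromℚ p)
  fromℚ-isReal p = record
    { below-inhabited = p - 1ℚ , <-gap 1ℚ (ℚ.positive⁻¹ 1ℚ) (p-1+1 p)
    ; above-inhabited = p + 1ℚ , <-gap 1ℚ (ℚ.positive⁻¹ 1ℚ) refl
    ; below-down      = ℚ.<-trans
    ; above-up        = λ q<r p<q → ℚ.<-trans p<q q<r
    ; below-open      = ℚ.<-dense
    ; above-open      = λ p<r → let q , p<q , q<r = ℚ.<-dense p<r in q , q<r , p<q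
    ; disjoint        = λ (q<p , p<q) → ℚ.<-asym q<p p<q
    ; located         = λ {q} {r} q<r → locate q<r (q ℚ.<? p)
    }
    where
    p-1+1 : ∀ p → p - 1ℚ + 1ℚ ≡ p
    p-1+1 = solve-∀ ℚ-ring
    locate : ∀ {q r} → q < r → Dec (q < p) → q < p ⊎ p < r
    locate q<r (yes q<p) = inj₁ q<p
    locate q<r (no q≮p)  = inj₂ (ℚ.≤-<-trans (ℚ.≮⇒≥ q≮p) q<r)

  -- With nonnegative endpoints `a * c` is the least of the four corner products, so one comparison
  -- replaces four.
  below-* : ∀ {x y p a b c d} → 0ℚ ≤ a → 0ℚ ≤ c → a ≤ b → c ≤ d →
    Between x a b → Between y c d → p < a * c → below (x ℝ.* y) p
  below-* {a = a} {b} {c} {d} 0≤a 0≤c a≤b c≤d x∈ y∈ p<ac =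
    a , b , c , d , x∈ , y∈ , p<ac ,
    ℚ.<-≤-trans p<ac (*-monoʳ-≤ 0≤a c≤d) ,
    ℚ.<-≤-trans p<ac (*-monoˡ-≤ 0≤c a≤b) ,
    ℚ.<-≤-trans p<ac (*-mono-≤ 0≤a 0≤c a≤b c≤d)

  above-* : ∀ {x y p a b c d} → 0ℚ ≤ a → 0ℚ ≤ c → a ≤ b → c ≤ d →
    Between x a b → Between y c d → b * d < p → above (x ℝ.* y) p
  above-* {a = a} {b} {c} {d} 0≤a 0≤c a≤b c≤d x∈ y∈ bd<p =
    a , b , c , d , x∈ , y∈ ,
    ℚ.≤-<-trans (*-mono-≤ 0≤a 0≤c a≤b c≤d) bd<p ,
    ℚ.≤-<-trans (*-monoˡ-≤ (ℚ.≤-trans 0≤c c≤d) a≤b) bd<p ,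
    ℚ.≤-<-trans (*-monoʳ-≤ (ℚ.≤-trans 0≤a a≤b) c≤d) bd<p ,
    bd<p

  below-log₂ : ∀ {x a} m → ν (2 ℕ.^ m) < a → below x a → below (log₂ x) (ν m)
  below-log₂ {x} {a} m 2^m<a x>a = subst (below (log₂ x)) (sym (ν≡mkℚ m))
    (a , ℚ.≤-<-trans (0≤ν (2 ℕ.^ m)) 2^m<a , x>a ,
     subst₂ _<_ (sym (pow2-+ m)) (sym (ℚ.*-identityʳ a)) 2^m<a)

  above-log₂ : ∀ {x a} m → 0ℚ < a → a < ν (2 ℕ.^ m) → above x a → above (log₂ x) (ν m)
  above-log₂ {x} {a} m 0<a a<2^m x<a = subst (above (log₂ x)) (sym (ν≡mkℚ m))
    (a , 0<a , x<a , subst₂ _<_ (sym (ℚ.*-identityʳ a)) (sym (pow2-+ m)) a<2^m)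

  module _ {ε : Cut} (ε-real : IsReal ε) where
    open IsReal ε-real

    below<above : ∀ {p q} → below ε p → above ε q → p < q
    below<above {p} {q} p<ε ε<q with p ℚ.<? q
    ... | yes p<q = p<q
    ... | no p≮q  = contradiction (p<ε , ε<p) disjoint
      where
      ε<p : above ε p
      ε<p with q ℚ.≟ p
      ... | yes refl = ε<q
      ... | no q≢p   = above-up (ℚ.≰⇒> λ p≤q → q≢p (ℚ.≤-antisym (ℚ.≮⇒≥ p≮q) p≤q)) ε<q

    -- Locatedness of `ε` between `½ ^ (j + 2)` and `½ ^ (j + 1)` either ends the search, since
    -- `ε < ½ ^ j` is four times the smaller power, or lowers the upper bound by one step. The two
    -- answers overlap, which is why the bracket has ratio 4 instead of 2. The fuel `k` runs out
    -- only in contradiction to `disjoint`.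
    dyadic-search : ∀ k j → above ε (½ ^ j) → below ε (½ ^ (j ℕ.+ k)) →
      ∃[ e ] Between ε (½ ^ e) (ν 4 * ½ ^ e)
    dyadic-search zero j ε<½^j ½^j<ε =
      contradiction (subst (λ i → below ε (½ ^ i)) (ℕ.+-identityʳ j) ½^j<ε , ε<½^j) disjoint
    dyadic-search (suc k) j ε<½^j ½^<ε =
      [ (λ ½^<ε′ → suc (suc j) , ½^<ε′ , subst (above ε) (sym (quadruple (½ ^ j))) ε<½^j)
      , (λ ε<½^j′ → dyadic-search k (suc j) ε<½^j′ (subst (λ i → below ε (½ ^ i)) (ℕ.+-suc j k) ½^<ε))
      ]′ (located {½ ^ suc (suc j)} {½ ^ suc j} (<-gap (½ ^ suc (suc j)) (0<½^ (suc (suc j))) (double (½ ^ j))))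
      where
      double : ∀ x → ½ * (½ * x) + ½ * (½ * x) ≡ ½ * x
      double = solve-∀ ℚ-ring
      quadruple : ∀ x → ν 4 * (½ * (½ * x)) ≡ x
      quadruple = solve-∀ ℚ-ring

    dyadic-approximation : fromℕ 0 ℝ.< ε → above ε 1ℚ → ∃[ e ] Between ε (½ ^ e) (ν 4 * ½ ^ e)
    dyadic-approximation (q , 0<q , q<ε) ε<1 = dyadic-search (↧ₙ q) 0 ε<1 (below-down (½^↧<p 0<q) q<ε)

    -- Since `z` is below `ε`, the bounds with `ε` are weaker. The work lies in interval
    -- multiplication, whose endpoints must all be strict.
    isApproximation : ∀ {z a} F → 0ℚ < z → below ε z → above ε 1ℚ →
      (1ℚ - z) * ν F ≤ a → a ≤ (1ℚ + z) * ν F → IsApproximation ε F a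
    isApproximation {z} {A} F 0<z z<ε ε<1 lower upper = low , high
      where
      z<1 : z < 1ℚ
      z<1 = below<above z<ε ε<1

      low : (fromℕ 1 ℝ.- ε) ℝ.* fromℕ F ℝ.≤ fromℚ A
      low q (a , _ , c , d , ((x , y , x<1 , ε<y , a<x-y) , _) , (c<F , F<d) , q<ac , q<ad , _) =
        ℚ.<-≤-trans (q<aF (ℚ.≤-total 0ℚ a)) (ℚ.≤-trans (*-monoˡ-≤ (0≤ν F) (ℚ.<⇒≤ a<1-z)) lower)
        where
        a<1-z : a < 1ℚ - z
        a<1-z = ℚ.<-trans a<x-y (ℚ.+-mono-< x<1 (ℚ.neg-antimono-< (below<above z<ε ε<y)))
        -- The lower endpoint `a` of `1 - ε` may be negative, and its sign decides which endpoint
        -- around `F` gives the useful corner.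
        q<aF : 0ℚ ≤ a ⊎ a ≤ 0ℚ → q < a * ν F
        q<aF (inj₁ 0≤a) = ℚ.<-≤-trans q<ac (*-monoʳ-≤ 0≤a (ℚ.<⇒≤ c<F))
        q<aF (inj₂ a≤0) = ℚ.<-≤-trans q<ad (ℚ.*-monoˡ-≤-nonPos a {{ℚ.nonPositive a≤0}} (ℚ.<⇒≤ F<d))

      high : fromℚ A ℝ.≤ (fromℕ 1 ℝ.+ ε) ℝ.* fromℕ F
      high q q<A =
        -- Here `ε < 1` makes 3 a safe upper endpoint for `1 + ε`. Lowering `F` by a quarter of the
        -- slack `η` costs at most `3 * ¼ * η < η` at either corner, so `q` stays below both.
        1ℚ + z , ν 3 , ν F - ¼ * η , ν F + 1ℚ ,
        (below-1+ε , above-1+ε) ,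
        (<-gap (¼ * η) 0<¼η (F-¼η+¼η (ν F) η) , <-gap 1ℚ 0<1 refl) ,
        <-gap (¼ * η * (ν 3 - z)) (0<p*q 0<¼η (p<q⇒0<q-p (ℚ.<-trans z<1 (ν-mono-< {1} {3} (s≤s (s≤s z≤n))))))
          (ac z (ν F) q) ,
        <-gap (η + (1ℚ + z)) (ℚ.+-mono-< 0<η (ℚ.+-mono-< 0<1 0<z)) (ad z (ν F) q) ,
        <-gap (¼ * η + (ν 2 - z) * ν F) (ℚ.+-mono-<-≤ 0<¼η 0≤[2-z]F) (bc z (ν F) q) ,
        <-gap (η + (ν 2 - z) * ν F + ν 3)
          (ℚ.+-mono-< (ℚ.+-mono-<-≤ 0<η 0≤[2-z]F) (ν-mono-< {0} {3} (s≤s z≤n))) (bd z (ν F) q)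
        where
        ¼ = ½ * ½
        η = (1ℚ + z) * ν F - q
        0<1 : 0ℚ < 1ℚ
        0<1 = ℚ.positive⁻¹ 1ℚ
        0<η : 0ℚ < η
        0<η = p<q⇒0<q-p (ℚ.<-≤-trans q<A upper)
        0<¼η : 0ℚ < ¼ * η
        0<¼η = 0<p*q {¼} (ℚ.positive⁻¹ ¼) 0<η
        0≤[2-z]F : 0ℚ ≤ (ν 2 - z) * ν F
        0≤[2-z]F = 0≤p*q (ℚ.<⇒≤ (p<q⇒0<q-p (ℚ.<-trans z<1 (ν-mono-< {1} {2} (s≤s (s≤s z≤n)))))) (0≤ν F)

        below-1+ε : below (fromℕ 1 ℝ.+ ε) (1ℚ + z)
        below-1+ε with r , z<r , r<ε ← below-open z<ε =
          1ℚ - ½ * (r - z) , r , <-gap (½ * (r - z)) 0<δ (cancel (½ * (r - z))) , r<ε ,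
          <-gap (½ * (r - z)) 0<δ (midpoint z r)
          where
          0<δ : 0ℚ < ½ * (r - z)
          0<δ = 0<p*q {½} (ℚ.positive⁻¹ ½) (p<q⇒0<q-p z<r)
          cancel : ∀ x → 1ℚ - x + x ≡ 1ℚ
          cancel = solve-∀ ℚ-ring
          midpoint : ∀ z r → 1ℚ + z + ½ * (r - z) ≡ 1ℚ - ½ * (r - z) + r
          midpoint = solve-∀ ℚ-ring
        above-1+ε : above (fromℕ 1 ℝ.+ ε) (ν 3)
        above-1+ε = 1ℚ + ½ , 1ℚ , <-gap ½ (ℚ.positive⁻¹ ½) refl , ε<1 , <-gap ½ (ℚ.positive⁻¹ ½) refl

        F-¼η+¼η : ∀ F η → F - ½ * ½ * η + ½ * ½ * η ≡ F
        F-¼η+¼η = solve-∀ ℚ-ring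
        ac : ∀ z F q → q + ½ * ½ * ((1ℚ + z) * F - q) * (ν 3 - z) ≡
          (1ℚ + z) * (F - ½ * ½ * ((1ℚ + z) * F - q))
        ac = solve-∀ ℚ-ring
        ad : ∀ z F q → q + ((1ℚ + z) * F - q + (1ℚ + z)) ≡ (1ℚ + z) * (F + 1ℚ)
        ad = solve-∀ ℚ-ring
        bc : ∀ z F q → q + (½ * ½ * ((1ℚ + z) * F - q) + (ν 2 - z) * F) ≡
          ν 3 * (F - ½ * ½ * ((1ℚ + z) * F - q))
        bc = solve-∀ ℚ-ring
        bd : ∀ z F q → q + ((1ℚ + z) * F - q + (ν 2 - z) * F + ν 3) ≡ ν 3 * (F + 1ℚ)
        bd = solve-∀ ℚ-ring

  -- Space

  -- A descent that keeps the first inequality: when the lower bound fails at `suc B`, the reverse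
  -- inequality is the upper bound at `B`. The upper bound limits the unary quotients; the lower one
  -- keeps `2 ^ suc b` at most `n / K`.
  rice-search : ∀ K n B → n ℕ.≤ 2 ℕ.^ B ℕ.* (4 ℕ.* K) →
    ∃[ b ] n ℕ.≤ 2 ℕ.^ b ℕ.* (4 ℕ.* K) × (b ≡ 0 ⊎ 2 ℕ.^ suc b ℕ.* K ℕ.≤ n)
  rice-search K n zero    upper = 0 , upper , inj₁ refl
  rice-search K n (suc B) upper with ℕ.≤-total (2 ℕ.^ suc (suc B) ℕ.* K) n
  ... | inj₁ lower = suc B , upper , inj₂ lower
  ... | inj₂ upper′ = rice-search K n B (subst (n ℕ.≤_) (regroup (2 ℕ.^ B) K) upper′)
    where
    regroup : ∀ x K → 2 ℕ.* (2 ℕ.* x) ℕ.* K ≡ x ℕ.* (4 ℕ.* K)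
    regroup = solve-∀ ℕ.ring

  rice-parameter : ∀ K n .{{_ : ℕ.NonZero K}} →
    ∃[ b ] n ℕ.≤ 2 ℕ.^ b ℕ.* (4 ℕ.* K) × (b ≡ 0 ⊎ 2 ℕ.^ suc b ℕ.* K ℕ.≤ n)
  rice-parameter K n = rice-search K n n
    (ℕ.≤-trans (ℕ.<⇒≤ (n<2^n n)) (ℕ.m≤m*n (2 ℕ.^ n) (4 ℕ.* K) {{ℕ.m*n≢0 4 K}}))

  -- One sign bit, and 8 / z² buckets for the precision z = ½ ^ e, so that
  -- Chebyshev's inequality bounds the failure probability by 1/4.
  hashBits : ℕ → ℕ
  hashBits e = suc (3 ℕ.+ (e ℕ.+ e))

  -- Each counter takes b + 1 bits besides its unary quotient; the quotients have
  -- sum at most n / 2 ^ b, which is at most 8 per counter.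
  space : ℕ → ℕ → ℕ
  space e b = 2 ℕ.^ hashBits e ℕ.* (b ℕ.+ 9)

  ½^e*½^e*2^hashBits : ∀ e → ½ ^ e * ½ ^ e * ν (2 ℕ.^ hashBits e) ≡ ν 16
  ½^e*½^e*2^hashBits e = begin
    z * z * ν (2 ℕ.^ hashBits e)        ≡⟨ cong (λ x → z * z * ν x) (ℕ.^-distribˡ-+-* 2 4 (e ℕ.+ e)) ⟩
    z * z * ν (16 ℕ.* 2 ℕ.^ (e ℕ.+ e))  ≡⟨ cong (λ x → z * z * ν (16 ℕ.* x)) (ℕ.^-distribˡ-+-* 2 e e) ⟩
    z * z * ν (16 ℕ.* (2 ℕ.^ e ℕ.* 2 ℕ.^ e))
      ≡⟨ cong (z * z *_) (trans (ν-* 16 (2 ℕ.^ e ℕ.* 2 ℕ.^ e)) (cong (ν 16 *_) (ν-* (2 ℕ.^ e) (2 ℕ.^ e)))) ⟩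
    z * z * (ν 16 * (Z * Z))            ≡⟨ regroup z Z ⟩
    ν 16 * (z * Z * (z * Z))            ≡⟨ cong (λ x → ν 16 * (x * x)) (½^e*2^e≡1 e) ⟩
    ν 16 * (1ℚ * 1ℚ)                    ≡⟨⟩
    ν 16                                ∎
    where
    open ≡-Reasoning
    z Z : ℚ
    z = ½ ^ e
    Z = ν (2 ℕ.^ e)
    regroup : ∀ z Z → z * z * (ν 16 * (Z * Z)) ≡ ν 16 * (z * Z * (z * Z))
    regroup = solve-∀ ℚ-ring

  module Space (e b : ℕ) {n : ℕ} {ε : Cut} (ε∈ : Between ε (½ ^ e) (ν 4 * ½ ^ e)) (1≤n : 1 ℕ.≤ n) (b-small : b ≡ 0 ⊎ 2 ℕ.^ suc b ℕ.* (2 ℕ.* 2 ℕ.^ hashBits e) ℕ.≤ n) where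

    z N : ℚ
    z = ½ ^ e
    N = ν n

    0<z : 0ℚ < z
    0<z = 0<½^ e
    0<zz : 0ℚ < z * z
    0<zz = 0<p*q 0<z 0<z
    0<N : 0ℚ < N
    0<N = ν-mono-< {0} {n} 1≤n
    0<zzN : 0ℚ < z * z * N
    0<zzN = 0<p*q 0<zz 0<N
    0<k : ∀ k → .{{ℕ.NonZero k}} → 0ℚ < ν k
    0<k k = ν-mono-< {0} {k} (ℕ.>-nonZero⁻¹ k)
    ⅛ = ½ * (½ * ½)
    1/32 = ½ * ½ * ⅛

    -- Squaring the bracket gives `z²` and `16 z²`; a further factor 2 on each side supplies
    -- strictness.
    ε²∈ : Between (ε ℝ.* ε) (½ * (z * z)) (ν 32 * (z * z))
    ε²∈ =
      below-* 0≤z 0≤z z≤4z z≤4z ε∈ ε∈ (<-gap (½ * (z * z)) (0<p*q {½} (ℚ.positive⁻¹ ½) 0<zz) (halves z)) ,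
      above-* 0≤z 0≤z z≤4z z≤4z ε∈ ε∈ (<-gap (ν 16 * (z * z)) (0<p*q {ν 16} (0<k 16) 0<zz) (sixteens z))
      where
      0≤z : 0ℚ ≤ z
      0≤z = ℚ.<⇒≤ 0<z
      halves : ∀ z → ½ * (z * z) + ½ * (z * z) ≡ z * z
      halves = solve-∀ ℚ-ring
      sixteens : ∀ z → ν 4 * z * (ν 4 * z) + ν 16 * (z * z) ≡ ν 32 * (z * z)
      sixteens = solve-∀ ℚ-ring
      one+three : ∀ z → z + ν 3 * z ≡ ν 4 * z
      one+three = solve-∀ ℚ-ring
      z≤4z : z ≤ ν 4 * z
      z≤4z = ≤-gap (ν 3 * z) (ℚ.<⇒≤ (0<p*q {ν 3} (0<k 3) 0<z)) (one+three z)

    n∈ : Between (fromℕ n) (½ * N) (ν (suc n))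
    n∈ = <-gap (½ * N) (0<p*q {½} (ℚ.positive⁻¹ ½) 0<N) (halves N) , ν-mono-< {n} {suc n} (ℕ.n<1+n n)
      where
      halves : ∀ z → ½ * z + ½ * z ≡ z
      halves = solve-∀ ℚ-ring

    ½zz≤32zz : ½ * (z * z) ≤ ν 32 * (z * z)
    ½zz≤32zz = *-monoˡ-≤ {p = ½} {ν 32} (ℚ.<⇒≤ 0<zz) (ℚ.≤ᵇ⇒≤ _)
    0≤½zz : 0ℚ ≤ ½ * (z * z)
    0≤½zz = ℚ.<⇒≤ (0<p*q {½} (ℚ.positive⁻¹ ½) 0<zz)
    ½N≤1+n : ½ * N ≤ ν (suc n)
    ½N≤1+n = ℚ.<⇒≤ (ℚ.<-trans (proj₁ n∈) (proj₂ n∈))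
    0≤½N : 0ℚ ≤ ½ * N
    0≤½N = ℚ.<⇒≤ (0<p*q {½} (ℚ.positive⁻¹ ½) 0<N)

    x : Cut
    x = fromℕ 2 ℝ.+ ε ℝ.* ε ℝ.* fromℕ n

    -- The endpoints for `ε * ε` and `n` multiply to a quarter of `z² n`. Each further halving buys
    -- one strict inequality: in the product, around the constant 2, and in the sum.
    below-x : below x (ν 2 + 1/32 * (z * z * N))
    below-x = ν 2 - ½ * (⅛ * (z * z * N)) , ⅛ * (z * z * N) ,
      <-gap (½ * (⅛ * (z * z * N))) (0<p*q {½} (ℚ.positive⁻¹ ½) 0<v) (cancel (½ * (⅛ * (z * z * N)))) ,
      below-* 0≤½zz 0≤½N ½zz≤32zz ½N≤1+n ε²∈ n∈ (<-gap (⅛ * (z * z * N)) 0<v (quarter z N)) ,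
      <-gap (1/32 * (z * z * N)) (0<p*q {1/32} (ℚ.positive⁻¹ 1/32) 0<zzN) (slack (z * z * N))
      where
      0<v : 0ℚ < ⅛ * (z * z * N)
      0<v = 0<p*q {⅛} (ℚ.positive⁻¹ ⅛) 0<zzN
      cancel : ∀ y → ν 2 - y + y ≡ ν 2
      cancel = solve-∀ ℚ-ring
      quarter : ∀ z N → ½ * (½ * ½) * (z * z * N) + ½ * (½ * ½) * (z * z * N) ≡ ½ * (z * z) * (½ * N)
      quarter = solve-∀ ℚ-ring
      slack : ∀ y → ν 2 + ½ * ½ * (½ * (½ * ½)) * y + ½ * ½ * (½ * (½ * ½)) * y ≡
        ν 2 - ½ * (½ * (½ * ½) * y) + ½ * (½ * ½) * y
      slack = solve-∀ ℚ-ring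

    -- For `b = 0` the summand 2 under the logarithm does the work. Otherwise `b-small` applies:
    -- with `W` counters `z² * W = 16`, so its factor `2 * W` matches the `1/32` of `below-x`.
    2^1+b<x : ν (2 ℕ.^ suc b) < ν 2 + 1/32 * (z * z * N)
    2^1+b<x = [ zero-case , large-case ]′ b-small
      where
      zero-case : b ≡ 0 → ν (2 ℕ.^ suc b) < ν 2 + 1/32 * (z * z * N)
      zero-case refl = <-gap (1/32 * (z * z * N)) (0<p*q {1/32} (ℚ.positive⁻¹ 1/32) 0<zzN) refl
      W = 2 ℕ.^ hashBits e
      large-case : 2 ℕ.^ suc b ℕ.* (2 ℕ.* W) ℕ.≤ n → ν (2 ℕ.^ suc b) < ν 2 + 1/32 * (z * z * N)
      large-case le = begin-strict
        ν (2 ℕ.^ suc b)                                ≡⟨ unit (ν (2 ℕ.^ suc b)) ⟩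
        1/32 * (ν 2 * ν 16 * ν (2 ℕ.^ suc b))          ≡⟨ cong (λ y → 1/32 * (ν 2 * y * ν (2 ℕ.^ suc b))) (½^e*½^e*2^hashBits e) ⟨
        1/32 * (ν 2 * (z * z * ν W) * ν (2 ℕ.^ suc b)) ≡⟨ regroup z (ν W) (ν (2 ℕ.^ suc b)) ⟩
        1/32 * (z * z * (ν (2 ℕ.^ suc b) * (ν 2 * ν W)))
          ≡⟨ cong (λ y → 1/32 * (z * z * y)) (trans (ν-* (2 ℕ.^ suc b) (2 ℕ.* W)) (cong (ν (2 ℕ.^ suc b) *_) (ν-* 2 W))) ⟨
        1/32 * (z * z * ν (2 ℕ.^ suc b ℕ.* (2 ℕ.* W)))
          ≤⟨ *-monoʳ-≤ {1/32} (ℚ.nonNegative⁻¹ 1/32) (*-monoʳ-≤ (ℚ.<⇒≤ 0<zz) (ν-mono-≤ {2 ℕ.^ suc b ℕ.* (2 ℕ.* W)} {n} le)) ⟩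
        1/32 * (z * z * N)                             <⟨ <-gap (ν 2) (0<k 2) (ℚ.+-comm (1/32 * (z * z * N)) (ν 2)) ⟩
        ν 2 + 1/32 * (z * z * N)                       ∎
        where
        open ℚ.≤-Reasoning
        unit : ∀ y → y ≡ ½ * ½ * (½ * (½ * ½)) * (ν 2 * ν 16 * y)
        unit = solve-∀ ℚ-ring
        regroup : ∀ z W y → ½ * ½ * (½ * (½ * ½)) * (ν 2 * (z * z * W) * y) ≡
          ½ * ½ * (½ * (½ * ½)) * (z * z * (y * (ν 2 * W)))
        regroup = solve-∀ ℚ-ring

    -- A crude upper endpoint, since a product of cuts asks for intervals bounded on both sides. It
    -- bounds `x` and, by `M < 2 ^ M`, also its logarithm; the summand `b` ensures `suc b ≤ M`.
    M : ℕ
    M = 33 ℕ.* suc n ℕ.+ (4 ℕ.+ b)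

    above-x : above x (ν M)
    above-x = ν 3 , ν (33 ℕ.* suc n) , ν-mono-< {2} {3} ℕ.≤-refl ,
      above-* 0≤½zz 0≤½N ½zz≤32zz ½N≤1+n ε²∈ n∈ upper ,
      subst (_< ν M) (ν-+ 3 (33 ℕ.* suc n)) (ν-mono-< {3 ℕ.+ 33 ℕ.* suc n} {M}
        (ℕ.≤-trans (ℕ.≤-reflexive (ℕ.+-comm 4 (33 ℕ.* suc n))) (ℕ.+-monoʳ-≤ (33 ℕ.* suc n) (ℕ.m≤m+n 4 b))))
      where
      open ℚ.≤-Reasoning
      upper : ν 32 * (z * z) * ν (suc n) < ν (33 ℕ.* suc n)
      upper = begin-strict
        ν 32 * (z * z) * ν (suc n)
          ≤⟨ *-monoˡ-≤ (0≤ν (suc n)) (*-monoʳ-≤ {ν 32} (0≤ν 32) (*-mono-≤ (ℚ.<⇒≤ 0<z) (ℚ.<⇒≤ 0<z) (½^≤1 e) (½^≤1 e))) ⟩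
        ν 32 * ν (suc n)          ≡⟨ ν-* 32 (suc n) ⟨
        ν (32 ℕ.* suc n)          <⟨ ν-mono-< {32 ℕ.* suc n} {33 ℕ.* suc n} (ℕ.*-monoˡ-< (suc n) (ℕ.n<1+n 32)) ⟩
        ν (33 ℕ.* suc n)          ∎

    log∈ : Between (log₂ x) (ν (suc b)) (ν M)
    log∈ = below-log₂ {x} (suc b) 2^1+b<x below-x ,
           above-log₂ {x} M (ν-mono-< {0} {M} (s≤s z≤n)) (ν-mono-< {M} {2 ℕ.^ M} (n<2^n M)) above-x

    scaled-space : ∀ k → ν (space e b) * (k * (z * z)) ≡ k * ν 16 * ν (b ℕ.+ 9)
    scaled-space k = begin
      ν (space e b) * (k * (z * z))            ≡⟨ cong (_* (k * (z * z))) (ν-* W (b ℕ.+ 9)) ⟩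
      ν W * ν (b ℕ.+ 9) * (k * (z * z))        ≡⟨ regroup (ν W) (ν (b ℕ.+ 9)) k z ⟩
      k * (z * z * ν W) * ν (b ℕ.+ 9)          ≡⟨ cong (λ y → k * y * ν (b ℕ.+ 9)) (½^e*½^e*2^hashBits e) ⟩
      k * ν 16 * ν (b ℕ.+ 9)                   ∎
      where
      open ≡-Reasoning
      W = 2 ℕ.^ hashBits e
      regroup : ∀ W B k z → W * B * (k * (z * z)) ≡ k * (z * z * W) * B
      regroup = solve-∀ ℚ-ring

    -- As ε² < 32 z², it suffices that s * 32 z² = 512 (b + 9) ≤ 4608 (b + 1); the
    -- slack between 4608 and 4610 is for the open intervals in the product of cuts.
    space-bound : fromℕ (space e b) ℝ.≤ fromℚ (ν 4610) ℝ.* log₂ x ℝ./ (ε ℝ.* ε)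
    space-bound q q<s =
      ν (4608 ℕ.* suc b) , ½ * (z * z) , ν 32 * (z * z) , below-C*log , ε²∈ , 0<½zz ,
      ℚ.<-≤-trans (*-monoˡ-< 0<½zz q<s) (ℚ.≤-trans (*-monoʳ-≤ (0≤ν (space e b)) ½zz≤32zz) fits) ,
      ℚ.<-≤-trans (*-monoˡ-< (0<p*q {ν 32} (0<k 32) 0<zz) q<s) fits
      where
      0<½zz : 0ℚ < ½ * (z * z)
      0<½zz = 0<p*q {½} (ℚ.positive⁻¹ ½) 0<zz
      below-C*log : below (fromℚ (ν 4610) ℝ.* log₂ x) (ν (4608 ℕ.* suc b))
      below-C*log = below-* {a = ν 4609} {ν 4611} (0≤ν 4609) (0≤ν (suc b))
        (ν-mono-≤ {4609} {4611} (ℕ.m≤n+m 4609 2))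
        (ν-mono-≤ {suc b} {M} (ℕ.≤-trans (ℕ.+-monoˡ-≤ b (s≤s {0} {3} z≤n)) (ℕ.m≤n+m (4 ℕ.+ b) (33 ℕ.* suc n))))
        (ν-mono-< {4609} {4610} (ℕ.n<1+n 4609) , ν-mono-< {4610} {4611} (ℕ.n<1+n 4610)) log∈
        (subst (ν (4608 ℕ.* suc b) <_) (ν-* 4609 (suc b))
          (ν-mono-< {4608 ℕ.* suc b} {4609 ℕ.* suc b} (ℕ.*-monoˡ-< (suc b) (ℕ.n<1+n 4608))))
      fits : ν (space e b) * (ν 32 * (z * z)) ≤ ν (4608 ℕ.* suc b)
      fits = begin
        ν (space e b) * (ν 32 * (z * z))   ≡⟨ scaled-space (ν 32) ⟩
        ν 512 * ν (b ℕ.+ 9)                ≡⟨ ν-* 512 (b ℕ.+ 9) ⟨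
        ν (512 ℕ.* (b ℕ.+ 9))              ≤⟨ ν-mono-≤ {512 ℕ.* (b ℕ.+ 9)} {4608 ℕ.* suc b} nat ⟩
        ν (4608 ℕ.* suc b)                 ∎
        where
        open ℚ.≤-Reasoning
        nat : 512 ℕ.* (b ℕ.+ 9) ℕ.≤ 4608 ℕ.* suc b
        nat = ℕ.≤-trans (ℕ.*-monoʳ-≤ 512 {b ℕ.+ 9} {9 ℕ.* suc b}
          (ℕ.≤-trans (ℕ.+-monoˡ-≤ 9 (ℕ.m≤n*m b 9)) (ℕ.≤-reflexive (nine b))))
          (ℕ.≤-reflexive (sym (ℕ.*-assoc 512 9 (suc b))))
          where
          nine : ∀ b → 9 ℕ.* b ℕ.+ 9 ≡ 9 ℕ.* suc b
          nine = solve-∀ ℕ.ring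

  -- The algorithm

  sketch : ∀ e b u → StreamingAlgorithm u (space e b) (u ℕ.* hashBits e)
  sketch e b u = record
    { initial = store b (space e b) {hashBits e} (const 0)
    ; update  = countHash b (space e b) (hashBits e)
    ; output  = λ _ m → ι (energy (load b (hashBits e) m))
    }

  run-sketch : ∀ e b {u n} → n ℕ.≤ 2 ℕ.^ b ℕ.* (4 ℕ.* (2 ℕ.* 2 ℕ.^ hashBits e)) →
    ∀ r (xs : Stream u n) → run (sketch e b u) r xs ≡ ι (Sketch.estimate (3 ℕ.+ (e ℕ.+ e)) (frequency xs) r)
  run-sketch e b {n = n} n≤ r xs = cong ι (energy-cong (load-stream b (space e b) (hashBits e) r xs fits))
    where
    W B : ℕ
    W = 2 ℕ.^ hashBits e
    B = 2 ℕ.^ b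
    merge : ∀ B W b → B ℕ.* (W ℕ.* suc b) ℕ.+ B ℕ.* (4 ℕ.* (2 ℕ.* W)) ≡ B ℕ.* (W ℕ.* (b ℕ.+ 9))
    merge = solve-∀ ℕ.ring
    fits : B ℕ.* (W ℕ.* suc b) ℕ.+ n ℕ.≤ B ℕ.* space e b
    fits = ℕ.≤-trans (ℕ.+-monoʳ-≤ (B ℕ.* (W ℕ.* suc b)) n≤) (ℕ.≤-reflexive (merge B W b))

  i≤∣i∣ : ∀ i → i ℤ.≤ + ℤ.∣ i ∣
  i≤∣i∣ (+ n)        = ℤ.≤-refl
  i≤∣i∣ ℤ.-[1+ n ]   = ℤ.-≤+

  near-bounds : ∀ e F A → T (near e F (A ℤ.- + F)) →
    (1ℚ - ½ ^ e) * ν F ≤ ι A × ι A ≤ (1ℚ + ½ ^ e) * ν F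
  near-bounds e F A close = lower , upper
    where
    open ℚ.≤-Reasoning
    z : ℚ
    z = ½ ^ e
    relative : ∀ i → ℤ.∣ i ∣ ≡ ℤ.∣ A ℤ.- + F ∣ → ι i ≤ z * ν F
    relative i eq = begin
      ι i                                   ≤⟨ ι-mono-≤ {i} {+ ℤ.∣ i ∣} (i≤∣i∣ i) ⟩
      ν ℤ.∣ i ∣                             ≡⟨ ℚ.*-identityˡ (ν ℤ.∣ i ∣) ⟨
      1ℚ * ν ℤ.∣ i ∣                        ≡⟨ cong (_* ν ℤ.∣ i ∣) (½^e*2^e≡1 e) ⟨
      z * ν (2 ℕ.^ e) * ν ℤ.∣ i ∣           ≡⟨ ℚ.*-assoc z (ν (2 ℕ.^ e)) (ν ℤ.∣ i ∣) ⟩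
      z * (ν (2 ℕ.^ e) * ν ℤ.∣ i ∣)         ≡⟨ cong (z *_) (ν-* (2 ℕ.^ e) ℤ.∣ i ∣) ⟨
      z * ν (2 ℕ.^ e ℕ.* ℤ.∣ i ∣)           ≤⟨ *-monoʳ-≤ (ℚ.<⇒≤ (0<½^ e)) (ν-mono-≤ {2 ℕ.^ e ℕ.* ℤ.∣ i ∣} {F}
                                                 (subst (λ k → 2 ℕ.^ e ℕ.* k ℕ.≤ F) (sym eq) (ℕ.≤ᵇ⇒≤ _ F close))) ⟩
      z * ν F                               ∎
    upper : ι A ≤ (1ℚ + z) * ν F
    upper = begin
      ι A                          ≡⟨ cong ι (split A (+ F)) ⟩
      ι (+ F ℤ.+ (A ℤ.- + F))      ≡⟨ ι-+ (+ F) (A ℤ.- + F) ⟩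
      ν F + ι (A ℤ.- + F)          ≤⟨ ℚ.+-monoʳ-≤ (ν F) (relative (A ℤ.- + F) refl) ⟩
      ν F + z * ν F                ≡⟨ factor z (ν F) ⟩
      (1ℚ + z) * ν F               ∎
      where
      split : ∀ A F → A ≡ F ℤ.+ (A ℤ.- F)
      split = solve-∀ ℤ.ring
      factor : ∀ z F → F + z * F ≡ (1ℚ + z) * F
      factor = solve-∀ ℚ-ring
    lower : (1ℚ - z) * ν F ≤ ι A
    lower = begin
      (1ℚ - z) * ν F               ≡⟨ cong ((1ℚ - z) *_) (trans (cong ι (split A (+ F))) (ι-+ A (+ F ℤ.- A))) ⟩
      (1ℚ - z) * (ι A + y)         ≤⟨ ≤-gap (z * ν F - y) 0≤gap gap-eq ⟩
      ι A                          ∎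
      where
      y : ℚ
      y = ι (+ F ℤ.- A)
      split : ∀ A F → F ≡ A ℤ.+ (F ℤ.- A)
      split = solve-∀ ℤ.ring
      0≤gap : 0ℚ ≤ z * ν F - y
      0≤gap = subst (_≤ z * ν F - y) (ℚ.+-inverseʳ y)
        (ℚ.+-monoˡ-≤ (- y) (relative (+ F ℤ.- A) (ℤ.∣i-j∣≡∣j-i∣ (+ F) A)))
      expand : ∀ z a y → (1ℚ - z) * (a + y) + (z * (a + y) - y) ≡ a
      expand = solve-∀ ℚ-ring
      gap-eq : (1ℚ - z) * (ι A + y) + (z * ν F - y) ≡ ι A
      gap-eq = trans
        (cong (λ f → (1ℚ - z) * (ι A + y) + (z * f - y)) (trans (cong ι (split A (+ F))) (ι-+ A (+ F ℤ.- A))))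
        (expand z (ι A) y)

  sketch-approximates : ∀ e b {u n} {ε : Cut} → IsReal ε → above ε 1ℚ → Between ε (½ ^ e) (ν 4 * ½ ^ e) →
    n ℕ.≤ 2 ℕ.^ b ℕ.* (4 ℕ.* (2 ℕ.* 2 ℕ.^ hashBits e)) → (xs : Stream u n) →
    ProbabilityExceeds (+ 2 ℚ./ 3) (λ r → IsApproximation ε (F₂ xs) (run (sketch e b u) r xs))
  sketch-approximates e b {ε = ε} ε-real ε<1 ε∈ n≤ xs =
    near e F ∘ error f , approximates , 2/3<Pr (near e F ∘ error f) (chebyshev e F (error f) (Σ-error² f))
    where
    open Sketch (3 ℕ.+ (e ℕ.+ e))
    f = frequency xs
    F = F₂ xs
    approximates : ∀ r → T (near e F (error f r)) → IsApproximation ε F (run (sketch e b _) r xs)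
    approximates r close =
      let lower , upper = near-bounds e F (estimate f r) close
      in subst (IsApproximation ε F) (sym (run-sketch e b n≤ r xs))
           (isApproximation ε-real F (0<½^ e) (proj₁ ε∈) ε<1 lower upper)

  sketch-solves : ∀ {n} → 1 ℕ.≤ n → ∀ {ε : Cut} → IsReal ε → above ε 1ℚ →
    ∀ e → Between ε (½ ^ e) (ν 4 * ½ ^ e) → ∀ u →
    ∃[ s ] ∃[ ℓ ] ∃[ alg ]
      (fromℕ s ℝ.≤ fromℚ (ν 4610) ℝ.* log₂ (fromℕ 2 ℝ.+ ε ℝ.* ε ℝ.* fromℕ n) ℝ./ (ε ℝ.* ε)) ×
      (∀ (xs : Stream u n) →
        ProbabilityExceeds {ℓ} (+ 2 ℚ./ 3) (λ r → IsApproximation ε (F₂ xs) (run {u} {s} {ℓ} alg r xs)))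
  sketch-solves {n} 1≤n ε-real ε<1 e ε∈ u =
    let b , n≤ , b-small = rice-parameter (2 ℕ.* 2 ℕ.^ hashBits e) n {{ℕ.m^n≢0 2 (suc (hashBits e))}}
    in space e b , u ℕ.* hashBits e , sketch e b u ,
       Space.space-bound e b ε∈ 1≤n b-small ,
       sketch-approximates e b ε-real ε<1 ε∈ n≤

open Reals

open import Defs

mainTheorem2 : ∀ (c₀ : Cut) → IsReal c₀ → fromℕ 0 < c₀ →
    ∃[ C ] IsReal C × fromℕ 0 < C ×
    (∀ (n : ℕ) → 1 ℕ.≤ n →
    ∀ (ε : Cut) → IsReal ε → fromℕ 0 < ε → ε < fromℕ 1 →
    c₀ / √ fromℕ n ≤ ε →
    ∀ (u : ℕ) →
    ∃[ s ] ∃[ ℓ ] ∃[ alg ]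
    (fromℕ s ≤ C * log₂ (fromℕ 2 + ε * ε * fromℕ n) / (ε * ε)) ×
    (∀ (xs : Stream u n) →
    ProbabilityExceeds {ℓ} (+ 2 ℚ./ 3)
    (λ r → IsApproximation ε (F₂ xs) (run {u} {s} {ℓ} alg r xs))))
mainTheorem2 _ _ _ =
  fromℚ (ν 4610) , fromℚ-isReal (ν 4610) ,
  (ν 1 , ν-mono-< {0} {1} (s≤s z≤n) , ν-mono-< {1} {4610} (s≤s (s≤s z≤n))) ,
  λ n 1≤n ε ε-real 0<ε (p , ε<p , p<1) _ u →
    let ε<1    = IsReal.above-up ε-real p<1 ε<p
        e , ε∈ = dyadic-approximation ε-real 0<ε ε<1
    in sketch-solves 1≤n ε-real ε<1 e ε∈ u
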